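{- For any ${\rm LP}^{\rm MLN}$ programs $\mathsf F$ and $\mathsf G$, program $\mathsf F$ is strongly equivalent to $\mathsf G$ if and only if there is a w-expression $c$ such that for every interpretation $X$: 1. $TW(\mathsf F_X)=c\times TW(\mathsf G_X)$, and 2. $(\overline{\mathsf F_X})^X$ and $(\overline{\mathsf G_X})^X$ are classically equivalent.
   Context: Propositional formulas are built from atoms of a propositional signature and $\bot$ using $\land,\lor,\rightarrow$, with $\neg F$ standing for $F\rightarrow\bot$ and $\top$ for $\bot\rightarrow\bot$. An interpretation is identified with the set of atoms true in it; $X\models R$ is classical satisfaction. The reduct $F^X$ of a formula $F$ relative to a set $X$ of atoms is obtained from $F$ by replacing every maximal subformula not (classically) satisfied by $X$ with $\bot$; for a set $\Gamma$ of formulas, $\Gamma^X=\{F^X\mid F\in\Gamma\}$. $X$ is a (standard) stable model of $\Gamma$ if $X$ is a minimal model (with respect to inclusion) of $\Gamma^X$. An ${\rm LP}^{\rm MLN}$ program is a finite set of weighted formulas $w:R$, where $R$ is a propositional formula and $w$ is a real number (soft rule) or the symbol $\alpha$ denoting infinite weight (hard rule). For a program $\mathsf F$, $\overline{\mathsf F}$ is the set of formulas obtained from $\mathsf F$ by dropping the weights, and $\mathsf F_X$ is the set of those $w:R$ in $\mathsf F$ with $X\models R$. $X$ is a soft stable model of $\mathsf F$ if $X$ is a stable model of $\overline{\mathsf F_X}$; ${\rm SM}[\mathsf F]$ is the set of soft stable models of $\mathsf F$. $TW(\mathsf F)$ denotes the expression $\exp\big(\sum_{w:R\in\mathsf F}w\big)$.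 The weight is $W_{\mathsf F}(X)=TW(\mathsf F_X)$ if $X\in{\rm SM}[\mathsf F]$ and $0$ otherwise, and the probability is $P_{\mathsf F}(X)=\lim_{\alpha\to\infty}\frac{W_{\mathsf F}(X)}{\sum_{Y\in{\rm SM}[\mathsf F]}W_{\mathsf F}(Y)}$. Programs $\mathsf F$ and $\mathsf G$ are strongly equivalent if, for any ${\rm LP}^{\rm MLN}$ program $\mathsf H$, $P_{\mathsf F\cup\mathsf H}(X)=P_{\mathsf G\cup\mathsf H}(X)$ for all interpretations $X$. A w-expression is an expression of the form $e^{c_1+c_2\alpha}$, where $c_1$ is a real number and $c_2$ is an integer.
   Formalization: Programs are finite multisets and F ∪ H adds multiplicities; with set union that merges identical weighted rules the "if" direction fails, e.g. F={1:p}, G={1:p∧p}, H={1:p}. -}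

module Defs where

open import Level using (0ℓ)
open import Algebra.Bundles using (CommutativeRing)
import Algebra.Properties.Monoid.Mult as MonoidMult
open import Axiom.ExcludedMiddle using (ExcludedMiddle)
open import Data.Bool using (Bool; T; if_then_else_)
open import Data.Bool.Properties using (T?)
open import Data.Empty using (⊥)
open import Data.Integer using (ℤ; +_; -[1+_])
open import Data.List using (List; []; _∷_; _++_; map; foldr; filter)
import Data.List.Membership.Setoid as Membership
open import Data.List.Relation.Unary.All using (All)
import Data.List.Relation.Unary.Unique.Setoid as UniqueSetoid
open import Data.Nat using (ℕ; suc)
open import Data.Product using (_×_; ∃)
open import Data.Sum using (_⊎_)
open import Function using (_⇔_)
open import Relation.Binary using (Rel; IsTotalOrder)
import Relation.Binary.Construct.NonStrictToStrict as ToStrict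
open import Relation.Binary.PropositionalEquality using (_→-setoid_)
open import Relation.Nullary using (¬_; Dec; no; does)
open import Relation.Nullary.Decidable using (_×-dec_; _⊎-dec_; _→-dec_)
open import Relation.Unary using (Pred)

-- The real numbers, given axiomatically as a Dedekind-complete ordered field
-- (unique up to isomorphism) with its exponential function.  The laws
-- exp (x + y) = exp x · exp y and 1 + x ≤ exp x determine exp uniquely: they
-- force (1 + x/n)ⁿ ≤ exp x ≤ (1 - x/n)⁻ⁿ for all large n.
record Reals : Set₁ where
  field
    commutativeRing : CommutativeRing 0ℓ 0ℓ

  open CommutativeRing commutativeRing public

  field
    0≉1 : ¬ (0# ≈ 1#)

    -- As usual the inverse is made total; 0# ⁻¹ is left unspecified.
    _⁻¹        : Carrier → Carrier
    ⁻¹-cong    : ∀ {x y} → x ≈ y → x ⁻¹ ≈ y ⁻¹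
    ⁻¹-inverse : ∀ {x} → ¬ (x ≈ 0#) → x * x ⁻¹ ≈ 1#

    _≤_          : Rel Carrier 0ℓ
    isTotalOrder : IsTotalOrder _≈_ _≤_
    +-monoˡ-≤    : ∀ {x y} z → x ≤ y → (x + z) ≤ (y + z)
    *-nonneg     : ∀ {x y} → 0# ≤ x → 0# ≤ y → 0# ≤ (x * y)

  _isUpperBoundOf_ : Carrier → Pred Carrier 0ℓ → Set
  b isUpperBoundOf S = ∀ x → S x → x ≤ b

  field
    complete : (S : Pred Carrier 0ℓ) → ∃ S → ∃ (_isUpperBoundOf S) →
               ∃ λ s → s isUpperBoundOf S × (∀ b → b isUpperBoundOf S → s ≤ b)

    exp      : Carrier → Carrier
    exp-cong : ∀ {x y} → x ≈ y → exp x ≈ exp y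
    exp-+    : ∀ x y → exp (x + y) ≈ exp x * exp y
    1+x≤exp  : ∀ x → (1# + x) ≤ exp x

  open ToStrict _≈_ _≤_ public using (_<_)

  infix 4 _≤_
  infix 8 _⁻¹

  open MonoidMult +-monoid using () renaming (_×_ to _×ℕ_)

  fromℤ : ℤ → Carrier
  fromℤ (+ n)    = n ×ℕ 1#
  fromℤ -[1+ n ] = - (suc n ×ℕ 1#)

  ∑ : {A : Set} → List A → (A → Carrier) → Carrier
  ∑ xs f = foldr _+_ 0# (map f xs)

  Lim∞ : (Carrier → Carrier) → Carrier → Set
  Lim∞ f l = ∀ ε → 0# < ε →
             ∃ λ A → ∀ α → A ≤ α → (l - ε) < f α × f α < (l + ε)

-- The metatheory of the paper is classical.  Excluded middle is needed to split
-- on whether X is a soft stable model, as the set At of atoms may be infinite.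
module LPMLN (em : ExcludedMiddle 0ℓ) (ℝ : Reals) (At : Set) where

  open Reals ℝ

  infixr 7 _∧′_
  infixr 6 _∨′_
  infixr 5 _→′_
  infix  4 _⊨_ _⊨?_ _⊨*_ _⊆_

  data Formula : Set where
    atom : At → Formula
    ⊥′   : Formula
    _∧′_ _∨′_ _→′_ : Formula → Formula → Formula

  -- Sets of atoms as characteristic functions, compared pointwise.
  Interpretation : Set
  Interpretation = At → Bool

  _⊆_ : Rel Interpretation 0ℓ
  X ⊆ Y = ∀ a → T (X a) → T (Y a)

  _⊨_ : Interpretation → Formula → Set
  X ⊨ atom a  = T (X a)
  X ⊨ ⊥′      = ⊥
  X ⊨ F ∧′ G  = (X ⊨ F) × (X ⊨ G)
  X ⊨ F ∨′ G  = (X ⊨ F) ⊎ (X ⊨ G)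
  X ⊨ F →′ G  = X ⊨ F → X ⊨ G

  _⊨?_ : ∀ X F → Dec (X ⊨ F)
  X ⊨? atom a  = T? (X a)
  X ⊨? ⊥′      = no λ ()
  X ⊨? F ∧′ G  = (X ⊨? F) ×-dec (X ⊨? G)
  X ⊨? F ∨′ G  = (X ⊨? F) ⊎-dec (X ⊨? G)
  X ⊨? F →′ G  = (X ⊨? F) →-dec (X ⊨? G)

  Theory : Set
  Theory = List Formula

  _⊨*_ : Interpretation → Theory → Set
  X ⊨* Γ = All (X ⊨_) Γ

  ClassicallyEquivalent : Theory → Theory → Set
  ClassicallyEquivalent Γ Δ = ∀ I → (I ⊨* Γ) ⇔ (I ⊨* Δ)

  reduct : Interpretation → Formula → Formula
  reduct X F = if does (X ⊨? F) then inside F else ⊥′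
    where
    inside : Formula → Formula
    inside (atom a) = atom a
    inside ⊥′       = ⊥′
    inside (F ∧′ G) = reduct X F ∧′ reduct X G
    inside (F ∨′ G) = reduct X F ∨′ reduct X G
    inside (F →′ G) = reduct X F →′ reduct X G

  reduct* : Interpretation → Theory → Theory
  reduct* X = map (reduct X)

  StableModel : Theory → Interpretation → Set
  StableModel Γ X = (X ⊨* reduct* X Γ) ×
                    (∀ Y → Y ⊆ X → Y ⊨* reduct* X Γ → X ⊆ Y)

  data Weight : Set where
    soft : Carrier → Weight
    hard : Weight

  infix 4 _∶_

  record WeightedFormula : Set where
    constructor _∶_
    field
      weight  : Weight
      formula : Formula

  open WeightedFormula public

  -- Programs are finite multisets and their union is _++_, which adds
  -- multiplicities, so that TW (F ∪ H) is TW F *ᵉ TW H.  If a rule common to F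
  -- and H were merged, F = {1 : p} and G = {1 : p ∧ p} would be told apart by
  -- H = {1 : p}, although TW (F ↾ X) ≈ᵉ TW (G ↾ X) and the reducts agree.
  Program : Set
  Program = List WeightedFormula

  _∪_ : Program → Program → Program
  _∪_ = _++_

  dropWeights : Program → Theory
  dropWeights = map formula

  infixl 9 _↾_

  _↾_ : Program → Interpretation → Program
  F ↾ X = filter (λ r → X ⊨? formula r) F

  SoftStable : Program → Interpretation → Set
  SoftStable F X = StableModel (dropWeights (F ↾ X)) X

  -- Expressions in the symbol α are functions of its real value.
  Expression : Set
  Expression = Carrier → Carrier

  _≈ᵉ_ : Rel Expression 0ℓ
  f ≈ᵉ g = ∀ α → f α ≈ g α

  _*ᵉ_ : Expression → Expression → Expression
  (f *ᵉ g) α = f α * g α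

  infix  4 _≈ᵉ_
  infixl 7 _*ᵉ_

  weightValue : Weight → Expression
  weightValue (soft w) α = w
  weightValue hard     α = α

  TW : Program → Expression
  TW F α = exp (∑ F λ r → weightValue (weight r) α)

  W : Program → Interpretation → Expression
  W F X α = if does (em {SoftStable F X}) then TW (F ↾ X) α else 0#

  InterpretationSetoid = At →-setoid Bool
  open Membership InterpretationSetoid using (_∈_)
  open UniqueSetoid InterpretationSetoid using (Unique)

  -- Ys lists the (finitely many) soft stable models of F, each exactly once.
  EnumeratesSM : Program → List Interpretation → Set
  EnumeratesSM F Ys = Unique Ys × (∀ Y → (Y ∈ Ys) ⇔ SoftStable F Y)

  -- P_F(X) exists and equals p.
  Probability : Program → Interpretation → Carrier → Set
  Probability F X p = ∃ λ Ys → EnumeratesSM F Ys ×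
    Lim∞ (λ α → W F X α * (∑ Ys λ Y → W F Y α) ⁻¹) p

  StronglyEquivalent : Program → Program → Set
  StronglyEquivalent F G =
    ∀ (H : Program) X → ∃ λ p → Probability (F ∪ H) X p × Probability (G ∪ H) X p

  record WExpression : Set where
    constructor e^[_+_α]
    field
      c₁ : Carrier
      c₂ : ℤ

  ⟦_⟧ : WExpression → Expression
  ⟦ e^[ c₁ + c₂ α] ⟧ α = exp (c₁ + fromℤ c₂ * α)

{-# OPTIONS --safe #-}
module Submission where

-- Grouping the weights, TW (P ↾ X) is e^(s + n α) with n the number of hard
-- rules of P that X satisfies.  Among the soft stable models those with maximal
-- n share the limit probability in proportion to e^s, the others get 0.
--
-- If TW and the reducts agree up to c, then F ∪ H and G ∪ H have the same soft
-- stable models and all weights differ by the factor c, which cancels.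
--
-- Conversely let S be the set of atoms of F and G.  Every H used below contains
-- copies of α : ¬¬D_X, where D_X describes X ∩ S; they do not affect
-- stability but, if numerous, make X one of the most probable models.
--  * With a ∨ ¬a for every a in S each subset of S becomes stable.  Balancing the
--    copies for X and for ∅ makes both limits positive, and comparing them gives
--    TW (F ↾ X) / TW (F ↾ ∅) = TW (G ↾ X) / TW (G ↾ ∅).
--  * If some Y ⊂ X satisfied the reduct of F but not that of G, then a formula
--    whose reduct relative to X has only the models Y and X below X would make X
--    stable for G and not for F, hence of positive probability for G only.

open import Defs
open import Level using (0ℓ)
import Algebra.Properties.Ring as RingProperties
import Algebra.Solver.Ring.NaturalCoefficients.Default as SemiringSolver
open import Axiom.ExcludedMiddle using (ExcludedMiddle)
open import Data.Bool using (true; false; T; _∧_; _∨_; if_then_else_)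
open import Data.Bool.Properties using (T-∧)
open import Data.Empty using (⊥; ⊥-elim)
open import Data.Integer using (+_; _⊖_)
import Data.Integer.Properties as ℤ
open import Data.List using (List; []; _∷_; _++_; map; filter; deduplicate; replicate)
import Data.List.Membership.Setoid as SetoidMembership
import Data.List.Membership.Setoid.Properties as SetoidMembershipₚ
open import Data.List.Membership.Propositional using (_∈_)
open import Data.List.Properties using (filter-++; filter-all; filter-none)
open import Data.List.Relation.Unary.All as All using (All; []; _∷_)
import Data.List.Relation.Unary.All.Properties as Allₚ
open import Data.List.Relation.Unary.AllPairs using ([]; _∷_)
open import Data.List.Relation.Unary.Any as Any using (Any; here; there; _─_)
import Data.List.Relation.Unary.Unique.Setoid as UniqueSetoid
import Data.List.Relation.Unary.Unique.Setoid.Properties as UniqueSetoidₚ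
import Data.List.Relation.Unary.Unique.DecSetoid.Properties as UniqueDecSetoidₚ
open import Data.Nat as ℕ using (ℕ; zero; suc; z≤n; s≤s)
import Data.Nat.Properties as ℕ
open import Data.Product as Product using (_×_; ∃; ∃₂; _,_; proj₁; proj₂)
open import Data.Sum as Sum using (_⊎_; inj₁; inj₂)
open import Data.Unit using (tt)
open import Function using (_⇔_; mk⇔; Equivalence; _∘_; id)
open import Relation.Binary using (DecSetoid; IsTotalOrder; Poset; Setoid)
import Relation.Binary.Reasoning.PartialOrder as PartialOrderReasoning
open import Relation.Binary.PropositionalEquality as ≡ using (_≡_; _≗_)
open import Relation.Nullary using (¬_; Dec; yes; no; does; contradiction)
open import Relation.Nullary.Decidable using (dec-true; dec-false; decidable-stable)

-- Real analysis: arithmetic and order in the field of reals.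

module RealAnalysis (em : ExcludedMiddle 0ℓ) (ℝ : Reals) where

  open Reals ℝ
  open RingProperties ring using (-1*x≈-x; -‿involutive)
  open IsTotalOrder isTotalOrder public
    using (isPartialOrder; total; antisym)
    renaming (refl to ≤-refl; trans to ≤-trans; reflexive to ≤-reflexive)

  poset : Poset 0ℓ 0ℓ 0ℓ
  poset = record { isPartialOrder = isPartialOrder }

  open PartialOrderReasoning poset
  open SemiringSolver commutativeSemiring

  ≰⇒> : ∀ {x y} → ¬ (x ≤ y) → y < x
  ≰⇒> {x} {y} x≰y with total x y
  ... | inj₁ x≤y = contradiction x≤y x≰y
  ... | inj₂ y≤x = y≤x , λ y≈x → x≰y (≤-reflexive (sym y≈x))

  <⇒≱ : ∀ {x y} → x < y → ¬ (y ≤ x)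
  <⇒≱ (x≤y , x≉y) y≤x = x≉y (antisym x≤y y≤x)

  pos⇒≉0 : ∀ {x} → 0# < x → ¬ (x ≈ 0#)
  pos⇒≉0 (_ , 0≉x) x≈0 = 0≉x (sym x≈0)

  <-≤-trans : ∀ {x y z} → x < y → y ≤ z → x < z
  <-≤-trans {x} {y} {z} x<y y≤z = begin-strict x <⟨ x<y ⟩ y ≤⟨ y≤z ⟩ z ∎

  upperBound : ∀ x y → ∃ λ z → x ≤ z × y ≤ z
  upperBound x y with total x y
  ... | inj₁ x≤y = y , x≤y , ≤-refl
  ... | inj₂ y≤x = x , ≤-refl , y≤x

  [x-y]+y≈x : ∀ x y → (x - y) + y ≈ x
  [x-y]+y≈x x y = begin-equality
    (x - y) + y      ≈⟨ +-assoc x (- y) y ⟩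
    x + (- y + y)    ≈⟨ +-congˡ (-‿inverseˡ y) ⟩
    x + 0#           ≈⟨ +-identityʳ x ⟩
    x                ∎

  [x+y]-y≈x : ∀ x y → (x + y) - y ≈ x
  [x+y]-y≈x x y = begin-equality
    (x + y) - y      ≈⟨ +-assoc x y (- y) ⟩
    x + (y - y)      ≈⟨ +-congˡ (-‿inverseʳ y) ⟩
    x + 0#           ≈⟨ +-identityʳ x ⟩
    x                ∎

  +-mono-≤ : ∀ {x y u v} → x ≤ y → u ≤ v → x + u ≤ y + v
  +-mono-≤ {x} {y} {u} {v} x≤y u≤v = begin
    x + u  ≤⟨ +-monoˡ-≤ u x≤y ⟩
    y + u  ≈⟨ +-comm y u ⟩
    u + y  ≤⟨ +-monoˡ-≤ y u≤v ⟩
    v + y  ≈⟨ +-comm v y ⟩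
    y + v  ∎

  +-cancelʳ-≤ : ∀ {x y} z → x + z ≤ y + z → x ≤ y
  +-cancelʳ-≤ {x} {y} z le = begin
    x            ≈⟨ [x+y]-y≈x x z ⟨
    (x + z) - z  ≤⟨ +-monoˡ-≤ (- z) le ⟩
    (y + z) - z  ≈⟨ [x+y]-y≈x y z ⟩
    y            ∎

  +-monoʳ-< : ∀ x {y z} → y < z → x + y < x + z
  +-monoʳ-< x {y} {z} y<z = ≰⇒> λ le → <⇒≱ y<z (+-cancelʳ-≤ x (begin
    z + x  ≈⟨ +-comm z x ⟩
    x + z  ≤⟨ le ⟩
    x + y  ≈⟨ +-comm x y ⟩
    y + x  ∎))

  0≤-+ : ∀ {x y} → 0# ≤ x → 0# ≤ y → 0# ≤ x + y
  0≤-+ {x} {y} 0≤x 0≤y = begin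
    0#       ≈⟨ +-identityʳ 0# ⟨
    0# + 0#  ≤⟨ +-mono-≤ 0≤x 0≤y ⟩
    x + y    ∎

  x≤x+y : ∀ {x y} → 0# ≤ y → x ≤ x + y
  x≤x+y {x} {y} 0≤y = begin
    x       ≈⟨ +-identityʳ x ⟨
    x + 0#  ≤⟨ +-mono-≤ ≤-refl 0≤y ⟩
    x + y   ∎

  0≤y-x : ∀ {x y} → x ≤ y → 0# ≤ y - x
  0≤y-x {x} {y} x≤y = begin
    0#     ≈⟨ -‿inverseʳ x ⟨
    x - x  ≤⟨ +-monoˡ-≤ (- x) x≤y ⟩
    y - x  ∎

  0<y-x : ∀ {x y} → x < y → 0# < y - x
  0<y-x {x} {y} x<y = 0≤y-x (proj₁ x<y) , λ 0≈y-x → <⇒≱ x<y (begin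
    y            ≈⟨ [x-y]+y≈x y x ⟨
    (y - x) + x  ≈⟨ +-congʳ 0≈y-x ⟨
    0# + x       ≈⟨ +-identityˡ x ⟩
    x            ∎)

  x≤0⇒0≤-x : ∀ {x} → x ≤ 0# → 0# ≤ - x
  x≤0⇒0≤-x {x} x≤0 = begin
    0#      ≤⟨ 0≤y-x x≤0 ⟩
    0# - x  ≈⟨ +-identityˡ (- x) ⟩
    - x     ∎

  *-monoˡ-≤ : ∀ {x y z} → 0# ≤ z → x ≤ y → x * z ≤ y * z
  *-monoˡ-≤ {x} {y} {z} 0≤z x≤y = begin
    x * z                ≤⟨ x≤x+y (*-nonneg (0≤y-x x≤y) 0≤z) ⟩
    x * z + (y - x) * z  ≈⟨ solve 3 (λ a b c → a :* b :+ c :* b := (c :+ a) :* b) refl x z (y - x) ⟩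
    ((y - x) + x) * z    ≈⟨ *-congʳ ([x-y]+y≈x y x) ⟩
    y * z                ∎

  *-monoʳ-≤ : ∀ {x y z} → 0# ≤ z → x ≤ y → z * x ≤ z * y
  *-monoʳ-≤ {x} {y} {z} 0≤z x≤y = begin
    z * x  ≈⟨ *-comm z x ⟩
    x * z  ≤⟨ *-monoˡ-≤ 0≤z x≤y ⟩
    y * z  ≈⟨ *-comm y z ⟩
    z * y  ∎

  0<1 : 0# < 1#
  0<1 = 0≤1 , 0≉1
    where
    0≤1 : 0# ≤ 1#
    0≤1 with total 0# 1#
    ... | inj₁ 0≤1 = 0≤1
    ... | inj₂ 1≤0 = begin
      0#           ≤⟨ *-nonneg (x≤0⇒0≤-x 1≤0) (x≤0⇒0≤-x 1≤0) ⟩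
      - 1# * - 1#  ≈⟨ -1*x≈-x (- 1#) ⟩
      - (- 1#)     ≈⟨ -‿involutive 1# ⟩
      1#           ∎

  *-cancelʳ-≈ : ∀ {x y z} → 0# < z → x * z ≈ y * z → x ≈ y
  *-cancelʳ-≈ {x} {y} {z} 0<z xz≈yz = begin-equality
    x               ≈⟨ *-identityʳ x ⟨
    x * 1#          ≈⟨ *-congˡ (⁻¹-inverse (pos⇒≉0 0<z)) ⟨
    x * (z * z ⁻¹)  ≈⟨ *-assoc x z (z ⁻¹) ⟨
    (x * z) * z ⁻¹  ≈⟨ *-congʳ xz≈yz ⟩
    (y * z) * z ⁻¹  ≈⟨ *-assoc y z (z ⁻¹) ⟩
    y * (z * z ⁻¹)  ≈⟨ *-congˡ (⁻¹-inverse (pos⇒≉0 0<z)) ⟩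
    y * 1#          ≈⟨ *-identityʳ y ⟩
    y               ∎

  *-monoˡ-< : ∀ {x y z} → 0# < z → x < y → x * z < y * z
  *-monoˡ-< 0<z (x≤y , x≉y) =
    *-monoˡ-≤ (proj₁ 0<z) x≤y , λ xz≈yz → x≉y (*-cancelʳ-≈ 0<z xz≈yz)

  *-cancelʳ-≤ : ∀ {x y z} → 0# < z → x * z ≤ y * z → x ≤ y
  *-cancelʳ-≤ {x} {y} 0<z xz≤yz with em {x ≤ y}
  ... | yes x≤y = x≤y
  ... | no  x≰y = contradiction xz≤yz (<⇒≱ (*-monoˡ-< 0<z (≰⇒> x≰y)))

  *-cancelʳ-< : ∀ {x y z} → 0# < z → x * z < y * z → x < y
  *-cancelʳ-< 0<z xz<yz = ≰⇒> λ y≤x → <⇒≱ xz<yz (*-monoˡ-≤ (proj₁ 0<z) y≤x)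

  *-pos : ∀ {x y} → 0# < x → 0# < y → 0# < x * y
  *-pos {x} {y} 0<x 0<y = begin-strict
    0#      ≈⟨ zeroˡ y ⟨
    0# * y  <⟨ *-monoˡ-< 0<y 0<x ⟩
    x * y   ∎

  +-pos : ∀ {x y} → 0# < x → 0# ≤ y → 0# < x + y
  +-pos 0<x 0≤y = <-≤-trans 0<x (x≤x+y 0≤y)

  ⁻¹-inverseˡ : ∀ {x} → 0# < x → x ⁻¹ * x ≈ 1#
  ⁻¹-inverseˡ 0<x = trans (*-comm _ _) (⁻¹-inverse (pos⇒≉0 0<x))

  ⁻¹-pos : ∀ {x} → 0# < x → 0# < x ⁻¹
  ⁻¹-pos {x} 0<x = *-cancelʳ-< 0<x (begin-strict
    0# * x    ≈⟨ zeroˡ x ⟩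
    0#        <⟨ 0<1 ⟩
    1#        ≈⟨ ⁻¹-inverseˡ 0<x ⟨
    x ⁻¹ * x  ∎)

  x*y⁻¹*y≈x : ∀ x {y} → 0# < y → (x * y ⁻¹) * y ≈ x
  x*y⁻¹*y≈x x {y} 0<y = begin-equality
    (x * y ⁻¹) * y  ≈⟨ *-assoc x (y ⁻¹) y ⟩
    x * (y ⁻¹ * y)  ≈⟨ *-congˡ (⁻¹-inverseˡ 0<y) ⟩
    x * 1#          ≈⟨ *-identityʳ x ⟩
    x               ∎

  -- The exponential function.

  -- For nonnegative x this is immediate from `1+x≤exp`. For x ≤ 0 that bound may be negative, so it
  -- is applied to - x and to 0: the product exp x · exp (- x) = exp 0 and its second factor are
  -- positive.
  0<exp : ∀ x → 0# < exp x
  0<exp x with total 0# x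
  ... | inj₁ 0≤x = 0<exp-nonneg 0≤x
    where
    0<exp-nonneg : ∀ {y} → 0# ≤ y → 0# < exp y
    0<exp-nonneg {y} 0≤y = <-≤-trans (+-pos 0<1 0≤y) (1+x≤exp y)
  ... | inj₂ x≤0 = *-cancelʳ-< 0<exp-x (begin-strict
    0# * exp (- x)     ≈⟨ zeroˡ _ ⟩
    0#                 <⟨ <-≤-trans (+-pos 0<1 ≤-refl) (1+x≤exp 0#) ⟩
    exp 0#             ≈⟨ exp-cong (-‿inverseʳ x) ⟨
    exp (x - x)        ≈⟨ exp-+ x (- x) ⟩
    exp x * exp (- x)  ∎)
    where
    0<exp-x : 0# < exp (- x)
    0<exp-x = <-≤-trans (+-pos 0<1 (x≤0⇒0≤-x x≤0)) (1+x≤exp (- x))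

  exp-0 : exp 0# ≈ 1#
  exp-0 = *-cancelʳ-≈ (0<exp 0#) (begin-equality
    exp 0# * exp 0#  ≈⟨ exp-+ 0# 0# ⟨
    exp (0# + 0#)    ≈⟨ exp-cong (+-identityʳ 0#) ⟩
    exp 0#           ≈⟨ *-identityˡ _ ⟨
    1# * exp 0#      ∎)

  exp[-x]*exp[x]≈1 : ∀ x → exp (- x) * exp x ≈ 1#
  exp[-x]*exp[x]≈1 x = begin-equality
    exp (- x) * exp x  ≈⟨ exp-+ (- x) x ⟨
    exp (- x + x)      ≈⟨ exp-cong (-‿inverseˡ x) ⟩
    exp 0#             ≈⟨ exp-0 ⟩
    1#                 ∎

  1≤exp : ∀ {x} → 0# ≤ x → 1# ≤ exp x
  1≤exp {x} 0≤x = ≤-trans (x≤x+y 0≤x) (1+x≤exp x)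

  exp-mono : ∀ {x y} → x ≤ y → exp x ≤ exp y
  exp-mono {x} {y} x≤y = begin
    exp x                ≈⟨ *-identityˡ _ ⟨
    1# * exp x           ≤⟨ *-monoˡ-≤ (proj₁ (0<exp x)) (1≤exp (0≤y-x x≤y)) ⟩
    exp (y - x) * exp x  ≈⟨ exp-+ (y - x) x ⟨
    exp ((y - x) + x)    ≈⟨ exp-cong ([x-y]+y≈x y x) ⟩
    exp y                ∎

  exp[-x]*[1+x]≤1 : ∀ x → exp (- x) * (1# + x) ≤ 1#
  exp[-x]*[1+x]≤1 x = begin
    exp (- x) * (1# + x)  ≤⟨ *-monoʳ-≤ (proj₁ (0<exp (- x))) (1+x≤exp x) ⟩
    exp (- x) * exp x     ≈⟨ exp[-x]*exp[x]≈1 x ⟩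
    1#                    ∎

  -- With A = C / ε and α ≥ A, the product C e^(-α) is at most α ε e^(-α), which is less than (1 +
  -- α) ε e^(-α) ≤ ε. The bound 1 + α ≤ e^α is all that is needed.
  exp-decay : ∀ {C ε} → 0# ≤ C → 0# < ε →
              ∃ λ A → 0# ≤ A × ∀ α → A ≤ α → C * exp (- α) < ε
  exp-decay {C} {ε} 0≤C 0<ε = A , 0≤A , bound
    where
    A = C * ε ⁻¹

    0≤A : 0# ≤ A
    0≤A = *-nonneg 0≤C (proj₁ (⁻¹-pos 0<ε))

    bound : ∀ α → A ≤ α → C * exp (- α) < ε
    bound α A≤α = begin-strict
      C * e                  ≈⟨ *-congʳ (x*y⁻¹*y≈x C 0<ε) ⟨
      A * ε * e              ≤⟨ *-monoˡ-≤ (proj₁ (0<exp _)) (*-monoˡ-≤ (proj₁ 0<ε) A≤α) ⟩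
      α * ε * e              ≈⟨ +-identityˡ _ ⟨
      0# + α * ε * e         <⟨ gain ⟩
      ε * e + α * ε * e      ≈⟨ solve 3 (λ a b c → b :* c :+ a :* b :* c := c :* (con 1 :+ a) :* b) refl α ε e ⟩
      e * (1# + α) * ε       ≤⟨ *-monoˡ-≤ (proj₁ 0<ε) (exp[-x]*[1+x]≤1 α) ⟩
      1# * ε                 ≈⟨ *-identityˡ ε ⟩
      ε                      ∎
      where
      e = exp (- α)
      gain : 0# + α * ε * e < ε * e + α * ε * e
      gain = ≰⇒> λ le → <⇒≱ (*-pos 0<ε (0<exp (- α))) (+-cancelʳ-≤ _ le)

  -- Limits as α tends to infinity.

  -- Every convergence proof below has an error of at most C e^(-α). Both bounds are additive, so
  -- that no absolute values or subtractions occur in the estimates.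
  Lim∞-squeeze : ∀ {f l C} → 0# ≤ C →
                 (∀ α → 0# ≤ α → l ≤ f α + C * exp (- α)) →
                 (∀ α → 0# ≤ α → f α ≤ l + C * exp (- α)) → Lim∞ f l
  Lim∞-squeeze {f} {l} {C} 0≤C lower upper ε 0<ε =
    A , λ α A≤α → below α A≤α , above α A≤α
    where
    decay = exp-decay 0≤C 0<ε
    A = proj₁ decay
    0≤A = proj₁ (proj₂ decay)
    small = proj₂ (proj₂ decay)

    below : ∀ α → A ≤ α → (l - ε) < f α
    below α A≤α = ≰⇒> λ f≤l-ε → <⇒≱ l<f+ε (f+ε≤l f≤l-ε)
      where
      l<f+ε : l < f α + ε
      l<f+ε = begin-strict
        l                      ≤⟨ lower α (≤-trans 0≤A A≤α) ⟩
        f α + C * exp (- α)    <⟨ +-monoʳ-< (f α) (small α A≤α) ⟩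
        f α + ε                ∎

      f+ε≤l : f α ≤ l - ε → f α + ε ≤ l
      f+ε≤l f≤l-ε = begin
        f α + ε      ≤⟨ +-monoˡ-≤ ε f≤l-ε ⟩
        (l - ε) + ε  ≈⟨ [x-y]+y≈x l ε ⟩
        l            ∎

    above : ∀ α → A ≤ α → f α < l + ε
    above α A≤α = begin-strict
      f α                ≤⟨ upper α (≤-trans 0≤A A≤α) ⟩
      l + C * exp (- α)  <⟨ +-monoʳ-< l (small α A≤α) ⟩
      l + ε              ∎

  Lim∞-cong : ∀ {f g l} → (∀ α → f α ≈ g α) → Lim∞ f l → Lim∞ g l
  Lim∞-cong {f} {g} {l} f≈g lim ε 0<ε with lim ε 0<ε
  ... | A , close = A , λ α A≤α →
    (begin-strict l - ε <⟨ proj₁ (close α A≤α) ⟩ f α ≈⟨ f≈g α ⟩ g α ∎) ,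
    (begin-strict g α ≈⟨ f≈g α ⟨ f α <⟨ proj₂ (close α A≤α) ⟩ l + ε ∎)

  -- If p x exceeded q y by δ > 0, the tolerance ε = δ / (x + y) would make the two errors ε x and ε
  -- y add up to exactly δ; strict closeness of g at a common late α is then contradictory.
  Lim∞-scaled-mono : ∀ {f g p q x y} → 0# < x → 0# < y → Lim∞ f p → Lim∞ g q →
                     (∀ α → f α * x ≤ g α * y) → p * x ≤ q * y
  Lim∞-scaled-mono {f} {g} {p} {q} {x} {y} 0<x 0<y limf limg f≤g with em {p * x ≤ q * y}
  ... | yes px≤qy = px≤qy
  ... | no  px≰qy = contradiction ≤-refl (<⇒≱ absurd)
    where
    δ = p * x - q * y
    ε = δ * (x + y) ⁻¹

    0<x+y : 0# < x + y
    0<x+y = +-pos 0<x (proj₁ 0<y)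

    0<δ : 0# < δ
    0<δ = 0<y-x (≰⇒> px≰qy)

    0<ε : 0# < ε
    0<ε = *-pos 0<δ (⁻¹-pos 0<x+y)

    closeᶠ = limf ε 0<ε
    closeᵍ = limg ε 0<ε
    late = upperBound (proj₁ closeᶠ) (proj₁ closeᵍ)
    α = proj₁ late

    p≤f+ε : p ≤ f α + ε
    p≤f+ε = begin
      p            ≈⟨ [x-y]+y≈x p ε ⟨
      (p - ε) + ε  ≤⟨ +-monoˡ-≤ ε (proj₁ (proj₁ (proj₂ closeᶠ α (proj₁ (proj₂ late))))) ⟩
      f α + ε      ∎

    absurd : p * x < p * x
    absurd = begin-strict
      p * x                  ≤⟨ *-monoˡ-≤ (proj₁ 0<x) p≤f+ε ⟩
      (f α + ε) * x          ≈⟨ distribʳ x (f α) ε ⟩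
      f α * x + ε * x        ≤⟨ +-monoˡ-≤ (ε * x) (f≤g α) ⟩
      g α * y + ε * x        <⟨ ≰⇒> (λ le → <⇒≱ (*-monoˡ-< 0<y (proj₂ (proj₂ closeᵍ α (proj₂ (proj₂ late))))) (+-cancelʳ-≤ (ε * x) le)) ⟩
      (q + ε) * y + ε * x    ≈⟨ solve 4 (λ a b c d → (a :+ b) :* c :+ b :* d := b :* (d :+ c) :+ a :* c) refl q ε y x ⟩
      ε * (x + y) + q * y    ≈⟨ +-congʳ (x*y⁻¹*y≈x δ 0<x+y) ⟩
      δ + q * y              ≈⟨ [x-y]+y≈x (p * x) (q * y) ⟩
      p * x                  ∎

  Lim∞-scaled : ∀ {f g p q x y} → 0# < x → 0# < y → Lim∞ f p → Lim∞ g q →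
                (∀ α → f α * x ≈ g α * y) → p * x ≈ q * y
  Lim∞-scaled 0<x 0<y limf limg f≈g = antisym
    (Lim∞-scaled-mono 0<x 0<y limf limg (λ α → ≤-reflexive (f≈g α)))
    (Lim∞-scaled-mono 0<y 0<x limg limf (λ α → ≤-reflexive (sym (f≈g α))))

  Lim∞-unique : ∀ {f p q} → Lim∞ f p → Lim∞ f q → p ≈ q
  Lim∞-unique limp limq = *-cancelʳ-≈ 0<1 (Lim∞-scaled 0<1 0<1 limp limq (λ _ → refl))

  -- Monomials e^(s + n α).

  ι : ℕ → Carrier
  ι n = fromℤ (+ n)

  0≤ι : ∀ n → 0# ≤ ι n
  0≤ι zero    = ≤-refl
  0≤ι (suc n) = 0≤-+ (proj₁ 0<1) (0≤ι n)

  ι-mono : ∀ {m n} → m ℕ.≤ n → ι m ≤ ι n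
  ι-mono {n = n} z≤n = 0≤ι n
  ι-mono (s≤s m≤n)   = +-mono-≤ ≤-refl (ι-mono m≤n)

  ι-+ : ∀ m n → ι (m ℕ.+ n) ≈ ι m + ι n
  ι-+ zero    n = sym (+-identityˡ _)
  ι-+ (suc m) n = trans (+-congˡ (ι-+ m n)) (sym (+-assoc _ _ _))

  fromℤ-⊖ : ∀ m n → fromℤ (m ⊖ n) + ι n ≈ ι m
  fromℤ-⊖ zero    zero    = +-identityʳ _
  fromℤ-⊖ zero    (suc n) = -‿inverseˡ _
  fromℤ-⊖ (suc m) zero    = +-identityʳ _
  fromℤ-⊖ (suc m) (suc n) rewrite ℤ.[1+m]⊖[1+n]≡m⊖n m n = begin-equality
    fromℤ (m ⊖ n) + (1# + ι n)  ≈⟨ solve 2 (λ a b → a :+ (con 1 :+ b) := con 1 :+ (a :+ b)) refl (fromℤ (m ⊖ n)) (ι n) ⟩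
    1# + (fromℤ (m ⊖ n) + ι n)  ≈⟨ +-congˡ (fromℤ-⊖ m n) ⟩
    1# + ι m                    ∎

  mono : Carrier → ℕ → Carrier → Carrier
  mono s n α = exp (s + ι n * α)

  mono-split : ∀ s n α → mono s n α ≈ exp s * exp (ι n * α)
  mono-split s n α = exp-+ s (ι n * α)

  exp-ι-mono : ∀ {m n α} → m ℕ.≤ n → 0# ≤ α → exp (ι m * α) ≤ exp (ι n * α)
  exp-ι-mono m≤n 0≤α = exp-mono (*-monoˡ-≤ 0≤α (ι-mono m≤n))

  -- Exponents are natural numbers, so m < n means m + 1 ≤ n and leaves a whole factor e^α to spare.
  exp-ι-< : ∀ {m n α} → m ℕ.< n → 0# ≤ α →
            exp (ι m * α) ≤ exp (- α) * exp (ι n * α)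
  exp-ι-< {m} {n} {α} m<n 0≤α = begin
    exp (ι m * α)                              ≈⟨ *-identityˡ _ ⟨
    1# * exp (ι m * α)                         ≈⟨ *-congʳ (exp[-x]*exp[x]≈1 α) ⟨
    exp (- α) * exp α * exp (ι m * α)          ≈⟨ *-assoc _ _ _ ⟩
    exp (- α) * (exp α * exp (ι m * α))        ≈⟨ *-congˡ (exp-+ α (ι m * α)) ⟨
    exp (- α) * exp (α + ι m * α)              ≈⟨ *-congˡ (exp-cong (solve 2 (λ a b → a :+ b :* a := (con 1 :+ b) :* a) refl α (ι m))) ⟩
    exp (- α) * exp ((1# + ι m) * α)           ≤⟨ *-monoʳ-≤ (proj₁ (0<exp _)) (exp-ι-mono m<n 0≤α) ⟩
    exp (- α) * exp (ι n * α)                  ∎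

  exp-ratio : ∀ s t → exp (s - t) * exp t ≈ exp s
  exp-ratio s t = trans (sym (exp-+ (s - t) t)) (exp-cong ([x-y]+y≈x s t))

  mono-≡ : ∀ s t n α → mono s n α ≈ exp (s - t) * mono t n α
  mono-≡ s t n α = begin-equality
    mono s n α                               ≈⟨ mono-split s n α ⟩
    exp s * exp (ι n * α)                    ≈⟨ *-congʳ (exp-ratio s t) ⟨
    exp (s - t) * exp t * exp (ι n * α)      ≈⟨ *-assoc _ _ _ ⟩
    exp (s - t) * (exp t * exp (ι n * α))    ≈⟨ *-congˡ (mono-split t n α) ⟨
    exp (s - t) * mono t n α                 ∎

  mono-< : ∀ s t {m n α} → m ℕ.< n → 0# ≤ α →
           mono s m α ≤ exp (s - t) * exp (- α) * mono t n α
  mono-< s t {m} {n} {α} m<n 0≤α = begin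
    mono s m α                                                 ≈⟨ mono-≡ s t m α ⟩
    exp (s - t) * mono t m α                                   ≈⟨ *-congˡ (mono-split t m α) ⟩
    exp (s - t) * (exp t * exp (ι m * α))                      ≤⟨ *-monoʳ-≤ (proj₁ (0<exp _)) (*-monoʳ-≤ (proj₁ (0<exp t)) (exp-ι-< m<n 0≤α)) ⟩
    exp (s - t) * (exp t * (exp (- α) * exp (ι n * α)))        ≈⟨ solve 4 (λ a b c d → a :* (b :* (c :* d)) := a :* c :* (b :* d)) refl (exp (s - t)) (exp t) (exp (- α)) (exp (ι n * α)) ⟩
    exp (s - t) * exp (- α) * (exp t * exp (ι n * α))          ≈⟨ *-congˡ (mono-split t n α) ⟨
    exp (s - t) * exp (- α) * mono t n α                       ∎

  -- Leading terms and limits of ratios.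

  IsMonoUpTo : ℕ → (Carrier → Carrier) → Set
  IsMonoUpTo m w = ∃₂ λ s n → n ℕ.≤ m × (∀ α → w α ≈ mono s n α)

  -- w is (L + O(exp (- α))) times the monomial u.
  record Leading (u w : Carrier → Carrier) : Set where
    field
      L C    : Carrier
      C-nonneg : 0# ≤ C
      lower  : ∀ α → 0# ≤ α → L * u α ≤ w α
      upper  : ∀ α → 0# ≤ α → w α ≤ (L + C * exp (- α)) * u α

  -- A monomial of full degree m is an exact multiple of the reference monomial, with no error; one
  -- of lower degree has leading coefficient 0 and lies entirely in the error term.
  mono-leading : ∀ t {m w} → IsMonoUpTo m w → Leading (mono t m) w
  mono-leading t {m} {w} (s , n , n≤m , w≈mono) with ℕ.m≤n⇒m<n∨m≡n n≤m
  ... | inj₁ n<m = record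
    { L = 0#
    ; C = exp (s - t)
    ; C-nonneg = proj₁ (0<exp _)
    ; lower = λ α 0≤α → begin
        0# * mono t m α  ≈⟨ zeroˡ _ ⟩
        0#               ≤⟨ proj₁ (0<exp _) ⟩
        mono s n α       ≈⟨ w≈mono α ⟨
        w α              ∎
    ; upper = λ α 0≤α → begin
        w α                                            ≈⟨ w≈mono α ⟩
        mono s n α                                     ≤⟨ mono-< s t n<m 0≤α ⟩
        exp (s - t) * exp (- α) * mono t m α           ≈⟨ *-congʳ (+-identityˡ _) ⟨
        (0# + exp (s - t) * exp (- α)) * mono t m α    ∎
    }
  ... | inj₂ ≡.refl = record
    { L = exp (s - t)
    ; C = 0#
    ; C-nonneg = ≤-refl
    ; lower = λ α 0≤α → ≤-reflexive (sym (trans (w≈mono α) (mono-≡ s t n α)))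
    ; upper = λ α 0≤α → begin
        w α                                              ≈⟨ trans (w≈mono α) (mono-≡ s t n α) ⟩
        exp (s - t) * mono t n α                         ≈⟨ *-congʳ (+-identityʳ _) ⟨
        (exp (s - t) + 0#) * mono t n α                  ≈⟨ *-congʳ (+-congˡ (zeroˡ _)) ⟨
        (exp (s - t) + 0# * exp (- α)) * mono t n α      ∎
    }

  -- All summands are measured against the same monomial, so coefficients and error constants simply
  -- add.
  ∑-leading : ∀ {A : Set} t {m} {w : A → Carrier → Carrier} {ys} →
              All (λ y → IsMonoUpTo m (w y)) ys →
              Leading (mono t m) (λ α → ∑ ys λ y → w y α)
  ∑-leading t {m} [] = record
    { L = 0#
    ; C = 0#
    ; C-nonneg = ≤-refl
    ; lower = λ α 0≤α → ≤-reflexive (zeroˡ _)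
    ; upper = λ α 0≤α → ≤-reflexive (sym (begin-equality
        (0# + 0# * exp (- α)) * mono t m α  ≈⟨ *-congʳ (+-identityˡ _) ⟩
        0# * exp (- α) * mono t m α         ≈⟨ *-congʳ (zeroˡ _) ⟩
        0# * mono t m α                     ≈⟨ zeroˡ _ ⟩
        0#                                  ∎))
    }
  ∑-leading t {m} (my ∷ mys) = record
    { L = ℓ.L + ℓs.L
    ; C = ℓ.C + ℓs.C
    ; C-nonneg = 0≤-+ ℓ.C-nonneg ℓs.C-nonneg
    ; lower = λ α 0≤α → ≤-trans (≤-reflexive (distribʳ _ _ _)) (+-mono-≤ (ℓ.lower α 0≤α) (ℓs.lower α 0≤α))
    ; upper = λ α 0≤α → ≤-trans (+-mono-≤ (ℓ.upper α 0≤α) (ℓs.upper α 0≤α))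
        (≤-reflexive (solve 6 (λ a b c d e f → (a :+ b :* e) :* f :+ (c :+ d :* e) :* f := (a :+ c :+ (b :+ d) :* e) :* f)
          refl ℓ.L ℓ.C ℓs.L ℓs.C (exp (- α)) (mono t m α)))
    }
    where
    module ℓ  = Leading (mono-leading t my)
    module ℓs = Leading (∑-leading t mys)

  -- With S = (L + O(exp (- α))) u, the ratio u / S tends to 1 / L.
  Lim∞-leading : ∀ {u S} → (∀ α → 0# < u α) → (∀ α → u α ≤ S α) → Leading u S →
                 ∃ λ p → 0# < p × Lim∞ (λ α → u α * S α ⁻¹) p
  Lim∞-leading {u} {S} 0<u u≤S lead = L ⁻¹ , ⁻¹-pos 0<L , Lim∞-squeeze C-nonneg p≤r+Ce r≤p+Ce
    where
    open Leading lead

    r : Carrier → Carrier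
    r α = u α * S α ⁻¹

    1≤L+Ce : ∀ α → 0# ≤ α → 1# ≤ L + C * exp (- α)
    1≤L+Ce α 0≤α = *-cancelʳ-≤ (0<u α) (begin
      1# * u α                   ≈⟨ *-identityˡ _ ⟩
      u α                        ≤⟨ u≤S α ⟩
      S α                        ≤⟨ upper α 0≤α ⟩
      (L + C * exp (- α)) * u α  ∎)

    -- From u ≤ S the inequality 1 ≤ L + C e^(-α) holds for all α ≥ 0; a positive gap 1 - L would
    -- eventually exceed the error. This makes L invertible.
    1≤L : 1# ≤ L
    1≤L with em {1# ≤ L}
    ... | yes 1≤L = 1≤L
    ... | no  1≰L = contradiction (1≤L+Ce A 0≤A) (<⇒≱ L+Ce<1)
      where
      decay = exp-decay C-nonneg (0<y-x (≰⇒> 1≰L))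
      A = proj₁ decay
      0≤A = proj₁ (proj₂ decay)
      small = proj₂ (proj₂ decay)

      L+Ce<1 : L + C * exp (- A) < 1#
      L+Ce<1 = begin-strict
        L + C * exp (- A)  <⟨ +-monoʳ-< L (small A ≤-refl) ⟩
        L + (1# - L)       ≈⟨ +-comm _ _ ⟩
        (1# - L) + L       ≈⟨ [x-y]+y≈x 1# L ⟩
        1#                 ∎

    0<L : 0# < L
    0<L = <-≤-trans 0<1 1≤L

    0<S : ∀ α → 0# < S α
    0<S α = <-≤-trans (0<u α) (u≤S α)

    rS≈u : ∀ α → r α * S α ≈ u α
    rS≈u α = x*y⁻¹*y≈x (u α) (0<S α)

    r≤1 : ∀ α → r α ≤ 1#
    r≤1 α = *-cancelʳ-≤ (0<S α) (begin
      r α * S α  ≈⟨ rS≈u α ⟩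
      u α        ≤⟨ u≤S α ⟩
      S α        ≈⟨ *-identityˡ _ ⟨
      1# * S α   ∎)

    -- The lower bound of `Leading` has no error, so r L ≤ 1 already gives r ≤ 1 / L and the error
    -- term is only padding.
    r≤p+Ce : ∀ α → 0# ≤ α → r α ≤ L ⁻¹ + C * exp (- α)
    r≤p+Ce α 0≤α = ≤-trans
      (*-cancelʳ-≤ 0<L (*-cancelʳ-≤ (0<S α) (begin
        r α * L * S α       ≈⟨ solve 3 (λ a b c → a :* b :* c := b :* (a :* c)) refl (r α) L (S α) ⟩
        L * (r α * S α)     ≈⟨ *-congˡ (rS≈u α) ⟩
        L * u α             ≤⟨ lower α 0≤α ⟩
        S α                 ≈⟨ *-identityˡ _ ⟨
        1# * S α            ≈⟨ *-congʳ (⁻¹-inverseˡ 0<L) ⟨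
        L ⁻¹ * L * S α      ∎)))
      (x≤x+y (*-nonneg C-nonneg (proj₁ (0<exp _))))

    -- After multiplication by L: the upper bound gives 1 ≤ (L + C e) r, and r ≤ 1 ≤ L turns the
    -- error C e r into at most C e L.
    p≤r+Ce : ∀ α → 0# ≤ α → L ⁻¹ ≤ r α + C * exp (- α)
    p≤r+Ce α 0≤α = *-cancelʳ-≤ 0<L (begin
      L ⁻¹ * L                        ≈⟨ ⁻¹-inverseˡ 0<L ⟩
      1#                              ≤⟨ *-cancelʳ-≤ (0<S α) 1S≤ ⟩
      (L + C * e) * r α               ≈⟨ solve 3 (λ a b c → (a :+ b) :* c := c :* a :+ b :* c) refl L (C * e) (r α) ⟩
      r α * L + C * e * r α           ≤⟨ +-mono-≤ ≤-refl (*-monoʳ-≤ (*-nonneg C-nonneg (proj₁ (0<exp _))) (≤-trans (r≤1 α) 1≤L)) ⟩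
      r α * L + C * e * L             ≈⟨ distribʳ L (r α) (C * e) ⟨
      (r α + C * e) * L               ∎)
      where
      e = exp (- α)
      1S≤ : 1# * S α ≤ (L + C * e) * r α * S α
      1S≤ = begin
        1# * S α                    ≈⟨ *-identityˡ _ ⟩
        S α                         ≤⟨ upper α 0≤α ⟩
        (L + C * e) * u α           ≈⟨ *-congˡ (rS≈u α) ⟨
        (L + C * e) * (r α * S α)   ≈⟨ *-assoc _ _ _ ⟨
        (L + C * e) * r α * S α     ∎

  -- The denominator is at least a monomial of higher degree, so the ratio is at most e^(s - t)
  -- e^(-α).
  Lim∞-negligible : ∀ s t {m n} {u S : Carrier → Carrier} → m ℕ.< n → (∀ α → u α ≈ mono s m α) →
                    (∀ α → mono t n α ≤ S α) → Lim∞ (λ α → u α * S α ⁻¹) 0#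
  Lim∞-negligible s t {m} {n} {u} {S} m<n u≈mono mono≤S =
    Lim∞-squeeze (proj₁ (0<exp (s - t)))
      (λ α _ → 0≤-+ (*-nonneg (≤-trans (proj₁ (0<exp (s + ι m * α))) (≤-reflexive (sym (u≈mono α)))) (proj₁ (⁻¹-pos (0<S α))))
                    (0≤bound α))
      (λ α 0≤α → ≤-trans
        (*-cancelʳ-≤ (0<S α) (begin
          u α * S α ⁻¹ * S α                         ≈⟨ x*y⁻¹*y≈x (u α) (0<S α) ⟩
          u α                                        ≈⟨ u≈mono α ⟩
          mono s m α                                 ≤⟨ mono-< s t m<n 0≤α ⟩
          exp (s - t) * exp (- α) * mono t n α       ≤⟨ *-monoʳ-≤ (0≤bound α) (mono≤S α) ⟩
          exp (s - t) * exp (- α) * S α              ∎))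
        (≤-reflexive (sym (+-identityˡ _))))
    where
    0<S : ∀ α → 0# < S α
    0<S α = <-≤-trans (0<exp (t + ι n * α)) (mono≤S α)

    0≤bound : ∀ α → 0# ≤ exp (s - t) * exp (- α)
    0≤bound α = *-nonneg (proj₁ (0<exp (s - t))) (proj₁ (0<exp (- α)))

  Lim∞-zero : ∀ {f} → (∀ α → f α ≈ 0#) → Lim∞ f 0#
  Lim∞-zero f≈0 = Lim∞-squeeze ≤-refl
    (λ α _ → ≤-reflexive (sym (trans (+-cong (f≈0 α) (zeroˡ _)) (+-identityˡ _))))
    (λ α _ → ≤-reflexive (trans (f≈0 α) (sym (trans (+-identityˡ _) (zeroˡ _)))))

  -- Finite sums.

  ∑-nonneg : ∀ {A : Set} {f : A → Carrier} xs → (∀ x → 0# ≤ f x) → 0# ≤ ∑ xs f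
  ∑-nonneg []       0≤f = ≤-refl
  ∑-nonneg (x ∷ xs) 0≤f = 0≤-+ (0≤f x) (∑-nonneg xs 0≤f)

  -- Membership is replaced by `v ≈ f x` because interpretations occur in an enumeration only up to
  -- pointwise equality.
  term≤∑ : ∀ {A : Set} {f : A → Carrier} {v xs} → (∀ x → 0# ≤ f x) →
           Any (λ x → v ≈ f x) xs → v ≤ ∑ xs f
  term≤∑ {xs = _ ∷ xs} 0≤f (here v≈fx) = ≤-trans (≤-reflexive v≈fx) (x≤x+y (∑-nonneg xs 0≤f))
  term≤∑ {f = f} {v} {x ∷ xs} 0≤f (there v∈xs) = begin
    v                ≤⟨ term≤∑ 0≤f v∈xs ⟩
    ∑ xs f           ≈⟨ +-identityˡ _ ⟨
    0# + ∑ xs f      ≤⟨ +-monoˡ-≤ _ (0≤f x) ⟩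
    f x + ∑ xs f     ∎

  ∑-++ : ∀ {A : Set} (f : A → Carrier) xs ys → ∑ (xs ++ ys) f ≈ ∑ xs f + ∑ ys f
  ∑-++ f []       ys = sym (+-identityˡ _)
  ∑-++ f (x ∷ xs) ys = trans (+-congˡ (∑-++ f xs ys)) (sym (+-assoc _ _ _))

  ∑-scale : ∀ {A : Set} {f g : A → Carrier} {k} xs → (∀ x → f x ≈ k * g x) →
            ∑ xs f ≈ k * ∑ xs g
  ∑-scale {k = k} [] f≈kg = sym (zeroʳ k)
  ∑-scale {g = g} {k} (x ∷ xs) f≈kg =
    trans (+-cong (f≈kg x) (∑-scale xs f≈kg)) (sym (distribˡ k (g x) (∑ xs g)))

-- Stable models through the logic of here-and-there.

module StableModels (em : ExcludedMiddle 0ℓ) (ℝ : Reals) (At : Set) where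

  open Reals ℝ
  open RealAnalysis em ℝ
  open LPMLN em ℝ At
  open PartialOrderReasoning poset
  open SemiringSolver commutativeSemiring using (solve; _:=_; _:+_; _:*_)
  open Equivalence using (to; from)
  open SetoidMembership InterpretationSetoid using () renaming (_∈_ to _∈ᴵ_)
  open UniqueSetoid InterpretationSetoid using (Unique)

  infixr 7 _∩_
  infixl 8 _∣_
  infix  4 ⟨_,_⟩⊨_

  _∩_ : Interpretation → Interpretation → Interpretation
  (X ∩ Y) a = X a ∧ Y a

  ∅ : Interpretation
  ∅ _ = false

  -- Excluded middle decides membership, since equality of atoms need not be decidable.
  _∣_ : Interpretation → List At → Interpretation
  (X ∣ S) a = X a ∧ does (em {a ∈ S})

  ∣-⊆ : ∀ X S → X ∣ S ⊆ X
  ∣-⊆ X S a = proj₁ ∘ to T-∧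

  ∣-∈ : ∀ X S a → T ((X ∣ S) a) → a ∈ S
  ∣-∈ X S a t with em {a ∈ S}
  ... | yes a∈S = a∈S
  ... | no  _   = ⊥-elim (proj₂ (to (T-∧ {X a}) t))

  -- Y satisfies the reduct of F relative to X; for Y ⊆ X this is satisfaction
  -- in the logic of here-and-there.
  ⟨_,_⟩⊨_ : Interpretation → Interpretation → Formula → Set
  ⟨ Y , X ⟩⊨ atom a = T ((X ∩ Y) a)
  ⟨ Y , X ⟩⊨ ⊥′     = ⊥
  ⟨ Y , X ⟩⊨ F ∧′ G = (⟨ Y , X ⟩⊨ F) × (⟨ Y , X ⟩⊨ G)
  ⟨ Y , X ⟩⊨ F ∨′ G = (⟨ Y , X ⟩⊨ F) ⊎ (⟨ Y , X ⟩⊨ G)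
  ⟨ Y , X ⟩⊨ F →′ G = (X ⊨ F →′ G) × (⟨ Y , X ⟩⊨ F → ⟨ Y , X ⟩⊨ G)

  -- Persistence of here-and-there logic. The clauses for atoms and implications carry truth in X
  -- explicitly, so Y ⊆ X is not assumed.
  ht⇒⊨ : ∀ {X Y} F → ⟨ Y , X ⟩⊨ F → X ⊨ F
  ht⇒⊨ {X} (atom a) t = proj₁ (to (T-∧ {X a}) t)
  ht⇒⊨ (F ∧′ G) (f , g)  = ht⇒⊨ F f , ht⇒⊨ G g
  ht⇒⊨ (F ∨′ G) (inj₁ f) = inj₁ (ht⇒⊨ F f)
  ht⇒⊨ (F ∨′ G) (inj₂ g) = inj₂ (ht⇒⊨ G g)
  ht⇒⊨ (F →′ G) (p , _)  = p

  ⊨⇒ht : ∀ {X} F → X ⊨ F → ⟨ X , X ⟩⊨ F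
  ⊨⇒ht (atom a) t        = from T-∧ (t , t)
  ⊨⇒ht (F ∧′ G) (f , g)  = ⊨⇒ht F f , ⊨⇒ht G g
  ⊨⇒ht (F ∨′ G) (inj₁ f) = inj₁ (⊨⇒ht F f)
  ⊨⇒ht (F ∨′ G) (inj₂ g) = inj₂ (⊨⇒ht G g)
  ⊨⇒ht (F →′ G) p        = p , ⊨⇒ht G ∘ p ∘ ht⇒⊨ F

  reduct-atom : ∀ {X} a → X ⊨ atom a → reduct X (atom a) ≡ atom a
  reduct-atom {X} a p rewrite dec-true (X ⊨? atom a) p = ≡.refl

  reduct-∧ : ∀ {X} F G → X ⊨ F ∧′ G → reduct X (F ∧′ G) ≡ reduct X F ∧′ reduct X G
  reduct-∧ {X} F G p rewrite dec-true (X ⊨? F ∧′ G) p = ≡.refl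

  reduct-∨ : ∀ {X} F G → X ⊨ F ∨′ G → reduct X (F ∨′ G) ≡ reduct X F ∨′ reduct X G
  reduct-∨ {X} F G p rewrite dec-true (X ⊨? F ∨′ G) p = ≡.refl

  reduct-→ : ∀ {X} F G → X ⊨ F →′ G → reduct X (F →′ G) ≡ reduct X F →′ reduct X G
  reduct-→ {X} F G p rewrite dec-true (X ⊨? F →′ G) p = ≡.refl

  reduct-⊥ : ∀ {X} F → ¬ X ⊨ F → reduct X F ≡ ⊥′
  reduct-⊥ {X} F ¬p rewrite dec-false (X ⊨? F) ¬p = ≡.refl

  module _ (X Y : Interpretation) where

    reduct⇒⊨ : ∀ F → Y ⊨ reduct X F → X ⊨ F
    reduct⇒⊨ F r =
      decidable-stable (X ⊨? F) λ ¬p → ≡.subst (Y ⊨_) (reduct-⊥ F ¬p) r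

    -- The two directions are mutually recursive because implication is contravariant in its
    -- premise. They cover every Y, not only subsets of X, as classical equivalence of reducts
    -- ranges over all interpretations.
    reduct⇒ht : ∀ F → Y ⊨ reduct X F → ⟨ Y , X ⟩⊨ F
    ht⇒reduct : ∀ F → ⟨ Y , X ⟩⊨ F → Y ⊨ reduct X F

    reduct⇒ht (atom a) r = from T-∧ (p , ≡.subst (Y ⊨_) (reduct-atom {X} a p) r)
      where p = reduct⇒⊨ (atom a) r
    reduct⇒ht ⊥′ r = reduct⇒⊨ ⊥′ r
    reduct⇒ht (F ∧′ G) r
      with ≡.subst (Y ⊨_) (reduct-∧ {X} F G (reduct⇒⊨ (F ∧′ G) r)) r
    ... | f , g = reduct⇒ht F f , reduct⇒ht G g
    reduct⇒ht (F ∨′ G) r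
      with ≡.subst (Y ⊨_) (reduct-∨ {X} F G (reduct⇒⊨ (F ∨′ G) r)) r
    ... | inj₁ f = inj₁ (reduct⇒ht F f)
    ... | inj₂ g = inj₂ (reduct⇒ht G g)
    reduct⇒ht (F →′ G) r =
      p , λ f → reduct⇒ht G (≡.subst (Y ⊨_) (reduct-→ {X} F G p) r (ht⇒reduct F f))
      where p = reduct⇒⊨ (F →′ G) r

    ht⇒reduct (atom a) t with to (T-∧ {X a}) t
    ... | x , y = ≡.subst (Y ⊨_) (≡.sym (reduct-atom {X} a x)) y
    ht⇒reduct (F ∧′ G) h@(f , g) =
      ≡.subst (Y ⊨_) (≡.sym (reduct-∧ {X} F G (ht⇒⊨ (F ∧′ G) h))) (ht⇒reduct F f , ht⇒reduct G g)
    ht⇒reduct (F ∨′ G) h =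
      ≡.subst (Y ⊨_) (≡.sym (reduct-∨ {X} F G (ht⇒⊨ (F ∨′ G) h)))
        (Sum.map (ht⇒reduct F) (ht⇒reduct G) h)
    ht⇒reduct (F →′ G) (p , h) =
      ≡.subst (Y ⊨_) (≡.sym (reduct-→ {X} F G p)) (λ f → ht⇒reduct G (h (reduct⇒ht F f)))

  -- The premise `X ⊨ formula r` takes the place of the filter `P ↾ X`, so that models of the reduct
  -- are treated rule by rule and split along `_++_`.
  Models : Interpretation → Interpretation → Program → Set
  Models Y X = All (λ r → X ⊨ formula r → ⟨ Y , X ⟩⊨ formula r)

  models⇒reduct* : ∀ {X Y} P → Models Y X P → Y ⊨* reduct* X (dropWeights (P ↾ X))
  models⇒reduct* [] [] = []
  models⇒reduct* {X} {Y} (r ∷ P) (h ∷ hs) with X ⊨? formula r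
  ... | yes p = ht⇒reduct X Y (formula r) (h p) ∷ models⇒reduct* P hs
  ... | no  _ = models⇒reduct* P hs

  reduct*⇒models : ∀ {X Y} P → Y ⊨* reduct* X (dropWeights (P ↾ X)) → Models Y X P
  reduct*⇒models [] [] = []
  reduct*⇒models {X} {Y} (r ∷ P) hs with X ⊨? formula r | hs
  ... | yes _ | h ∷ hs′ = (λ _ → reduct⇒ht X Y (formula r) h) ∷ reduct*⇒models P hs′
  ... | no ¬p | hs′     = (λ p → contradiction p ¬p) ∷ reduct*⇒models P hs′

  models-refl : ∀ X P → Models X X P
  models-refl X P = All.universal (λ r → ⊨⇒ht (formula r)) P

  stable⁺ : ∀ P {X} → (∀ Y → Y ⊆ X → Models Y X P → X ⊆ Y) → SoftStable P X
  stable⁺ P {X} minimal =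
    models⇒reduct* P (models-refl X P) , λ Y Y⊆X m → minimal Y Y⊆X (reduct*⇒models P m)

  stable⁻ : ∀ P {X} → SoftStable P X → ∀ Y → Y ⊆ X → Models Y X P → X ⊆ Y
  stable⁻ P (_ , minimal) Y Y⊆X m = minimal Y Y⊆X (models⇒reduct* P m)

  -- Rules violated by ∅ are dropped, and ∅ has no proper subset. Hence every program has a soft
  -- stable model and a positive normalising sum.
  ∅-stable : ∀ P → SoftStable P ∅
  ∅-stable P = stable⁺ P λ _ _ _ _ ()

  -- Locality: only the occurring atoms matter.

  atoms : Formula → List At
  atoms (atom a) = a ∷ []
  atoms ⊥′       = []
  atoms (F ∧′ G) = atoms F ++ atoms G
  atoms (F ∨′ G) = atoms F ++ atoms G
  atoms (F →′ G) = atoms F ++ atoms G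

  atoms* : Program → List At
  atoms* []      = []
  atoms* (r ∷ P) = atoms (formula r) ++ atoms* P

  Agree : List At → Interpretation → Interpretation → Set
  Agree S X Y = All (λ a → X a ≡ Y a) S

  agree-sym : ∀ {S X Y} → Agree S X Y → Agree S Y X
  agree-sym = All.map ≡.sym

  agree-∩ : ∀ {S X X′ Y Y′} → Agree S X X′ → Agree S Y Y′ → Agree S (X ∩ Y) (X′ ∩ Y′)
  agree-∩ ax ay = All.zipWith (λ (x , y) → ≡.cong₂ _∧_ x y) (ax , ay)

  agree-∣ : ∀ X S → Agree S (X ∣ S) X
  agree-∣ X S = All.tabulate λ {a} a∈S → X∣S≡X a a∈S
    where
    X∣S≡X : ∀ a → a ∈ S → (X ∣ S) a ≡ X a
    X∣S≡X a a∈S rewrite dec-true (em {a ∈ S}) a∈S with X a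
    ... | true  = ≡.refl
    ... | false = ≡.refl

  agree-≗ : ∀ {S X Y} → X ≗ Y → Agree S X Y
  agree-≗ {S} X≗Y = All.universal X≗Y S

  ⊨-local : ∀ {X Y} F → Agree (atoms F) X Y → X ⊨ F → Y ⊨ F
  ⊨-local (atom a) (x≡y ∷ []) t = ≡.subst T x≡y t
  ⊨-local (F ∧′ G) ag (f , g)  = ⊨-local F (Allₚ.++⁻ˡ _ ag) f , ⊨-local G (Allₚ.++⁻ʳ (atoms F) ag) g
  ⊨-local (F ∨′ G) ag (inj₁ f) = inj₁ (⊨-local F (Allₚ.++⁻ˡ _ ag) f)
  ⊨-local (F ∨′ G) ag (inj₂ g) = inj₂ (⊨-local G (Allₚ.++⁻ʳ (atoms F) ag) g)
  ⊨-local (F →′ G) ag p        =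
    ⊨-local G (Allₚ.++⁻ʳ (atoms F) ag) ∘ p ∘ ⊨-local F (agree-sym (Allₚ.++⁻ˡ _ ag))

  -- Y enters `⟨ Y , X ⟩⊨ F` only through X ∩ Y, so agreement of the intersections suffices and Y
  -- may differ from Y′ outside X.
  ht-local : ∀ {X X′ Y Y′} F → Agree (atoms F) X X′ → Agree (atoms F) (X ∩ Y) (X′ ∩ Y′) →
             ⟨ Y , X ⟩⊨ F → ⟨ Y′ , X′ ⟩⊨ F
  ht-local (atom a) _ (eq ∷ []) t = ≡.subst T eq t
  ht-local (F ∧′ G) ag ag∩ (f , g) =
    ht-local F (Allₚ.++⁻ˡ _ ag) (Allₚ.++⁻ˡ _ ag∩) f ,
    ht-local G (Allₚ.++⁻ʳ (atoms F) ag) (Allₚ.++⁻ʳ (atoms F) ag∩) g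
  ht-local (F ∨′ G) ag ag∩ (inj₁ f) = inj₁ (ht-local F (Allₚ.++⁻ˡ _ ag) (Allₚ.++⁻ˡ _ ag∩) f)
  ht-local (F ∨′ G) ag ag∩ (inj₂ g) =
    inj₂ (ht-local G (Allₚ.++⁻ʳ (atoms F) ag) (Allₚ.++⁻ʳ (atoms F) ag∩) g)
  ht-local (F →′ G) ag ag∩ (p , h) =
    ⊨-local (F →′ G) ag p ,
    ht-local G (Allₚ.++⁻ʳ (atoms F) ag) (Allₚ.++⁻ʳ (atoms F) ag∩) ∘ h ∘
    ht-local F (agree-sym (Allₚ.++⁻ˡ _ ag)) (agree-sym (Allₚ.++⁻ˡ _ ag∩))

  models-local : ∀ {X X′ Y Y′} P → Agree (atoms* P) X X′ → Agree (atoms* P) (X ∩ Y) (X′ ∩ Y′) →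
                 Models Y X P → Models Y′ X′ P
  models-local [] _ _ [] = []
  models-local (r ∷ P) ag ag∩ (h ∷ hs) =
    (ht-local F (Allₚ.++⁻ˡ _ ag) (Allₚ.++⁻ˡ _ ag∩) ∘ h ∘ ⊨-local F (agree-sym (Allₚ.++⁻ˡ _ ag))) ∷
    models-local P (Allₚ.++⁻ʳ (atoms F) ag) (Allₚ.++⁻ʳ (atoms F) ag∩) hs
    where F = formula r

  ↾-local : ∀ {X Y} P → Agree (atoms* P) X Y → P ↾ X ≡ P ↾ Y
  ↾-local [] _ = ≡.refl
  ↾-local {X} {Y} (r ∷ P) ag with X ⊨? formula r | Y ⊨? formula r
  ... | yes _ | yes _ = ≡.cong (r ∷_) (↾-local P (Allₚ.++⁻ʳ (atoms (formula r)) ag))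
  ... | no  _ | no  _ = ↾-local P (Allₚ.++⁻ʳ (atoms (formula r)) ag)
  ... | yes p | no ¬q = contradiction (⊨-local (formula r) (Allₚ.++⁻ˡ _ ag) p) ¬q
  ... | no ¬p | yes q = contradiction (⊨-local (formula r) (agree-sym (Allₚ.++⁻ˡ _ ag)) q) ¬p

  stable-resp : ∀ P {X Y} → X ≗ Y → SoftStable P X → SoftStable P Y
  stable-resp P {X} {Y} X≗Y st = stable⁺ P λ Z Z⊆Y m a →
    stable⁻ P st Z
      (λ b → ≡.subst T (≡.sym (X≗Y b)) ∘ Z⊆Y b)
      (models-local P (agree-≗ (≡.sym ∘ X≗Y)) (agree-∩ (agree-≗ (≡.sym ∘ X≗Y)) (agree-≗ {Y = Z} λ _ → ≡.refl)) m) a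
    ∘ ≡.subst T (≡.sym (X≗Y a))

  -- Cutting X down to the atoms of P does not change satisfaction of the reduct, so minimality
  -- forbids any further atom in X.
  stable⊆atoms : ∀ P {X} → SoftStable P X → ∀ a → T (X a) → a ∈ atoms* P
  stable⊆atoms P {X} st a t = ∣-∈ X (atoms* P) a (stable⁻ P st (X ∣ atoms* P) (∣-⊆ X (atoms* P))
    (models-local P (agree-≗ λ _ → ≡.refl)
      (agree-∩ (agree-≗ {X = X} λ _ → ≡.refl) (agree-sym (agree-∣ X (atoms* P)))) (models-refl X P)) a t)

  -- Enumerating the soft stable models.

  insert : At → Interpretation → Interpretation
  insert a X b = X b ∨ does (em {a ≡ b})

  subsets : List At → List Interpretation
  subsets []      = ∅ ∷ []
  subsets (a ∷ S) = subsets S ++ map (insert a) (subsets S)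

  ∈-subsets : ∀ {X} S → (∀ a → T (X a) → a ∈ S) → X ∈ᴵ subsets S
  ∈-subsets {X} [] X⊆S = here λ a → X≡false a (X⊆S a)
    where
    X≡false : ∀ a → (T (X a) → a ∈ []) → X a ≡ false
    X≡false a f with X a
    ... | false = ≡.refl
    ... | true with f tt
    ... | ()
  ∈-subsets {X} (a ∷ S) X⊆S with em {T (X a)}
  -- X is the insertion of a into its restriction to S. If a occurs again in S, the restriction
  -- contains it already, which does no harm.
  ... | yes Xa = SetoidMembershipₚ.∈-++⁺ʳ InterpretationSetoid (subsets S)
        (SetoidMembershipₚ.∈-resp-≈ InterpretationSetoid (≡.sym ∘ X≗insert)
          (SetoidMembershipₚ.∈-map⁺ InterpretationSetoid InterpretationSetoid
            (λ Y≗Z b → ≡.cong (_∨ does (em {a ≡ b})) (Y≗Z b))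
            (∈-subsets S (∣-∈ X S))))
    where
    X≗insert : X ≗ insert a (X ∣ S)
    X≗insert b with em {a ≡ b} | em {b ∈ S} | X b in eq
    ... | yes ≡.refl | _      | true  = ≡.sym (∨-true _)
      where
      ∨-true : ∀ x → x ∨ true ≡ true
      ∨-true true  = ≡.refl
      ∨-true false = ≡.refl
    ... | yes ≡.refl | _      | false = ⊥-elim (≡.subst T eq Xa)
    ... | no _       | _      | false = ≡.refl
    ... | no _       | yes _  | true  = ≡.refl
    ... | no a≢b     | no b∉S | true with X⊆S b (≡.subst T (≡.sym eq) tt)
    ... | here b≡a  = contradiction (≡.sym b≡a) a≢b
    ... | there b∈S = contradiction b∈S b∉S
  ... | no ¬Xa = SetoidMembershipₚ.∈-++⁺ˡ InterpretationSetoid (∈-subsets S X⊆tail)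
    where
    X⊆tail : ∀ b → T (X b) → b ∈ S
    X⊆tail b Xb with X⊆S b Xb
    ... | here ≡.refl = contradiction Xb ¬Xa
    ... | there b∈S   = b∈S

  decSetoid : DecSetoid 0ℓ 0ℓ
  decSetoid = record { isDecEquivalence = record
    { isEquivalence = Setoid.isEquivalence InterpretationSetoid ; _≟_ = λ X Y → em } }

  -- All soft stable models are among the finitely many subsets of `atoms* P`. Repeated atoms make
  -- `subsets` repeat itself, hence the deduplication.
  enumeration : ∀ P → ∃ (EnumeratesSM P)
  enumeration P = filter stable? candidates ,
    UniqueSetoidₚ.filter⁺ InterpretationSetoid stable? (UniqueDecSetoidₚ.deduplicate-! decSetoid (subsets (atoms* P))) ,
    λ Y → mk⇔
      (λ Y∈ → proj₂ (SetoidMembershipₚ.∈-filter⁻ InterpretationSetoid stable? (stable-resp P) {xs = candidates} Y∈))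
      (λ st → SetoidMembershipₚ.∈-filter⁺ InterpretationSetoid stable? (stable-resp P)
        (SetoidMembershipₚ.∈-deduplicate⁺ InterpretationSetoid _≟_
          (λ Z≗Y X≗Y a → ≡.trans (X≗Y a) (≡.sym (Z≗Y a)))
          (∈-subsets (atoms* P) (stable⊆atoms P st))) st)
    where
    open DecSetoid decSetoid using (_≟_)
    stable? = λ Y → em {SoftStable P Y}
    candidates = deduplicate _≟_ (subsets (atoms* P))

  -- Weights of programs as monomials.

  hardness : Weight → ℕ
  hardness (soft _) = 0
  hardness hard     = 1

  softness : Weight → Carrier
  softness (soft w) = w
  softness hard     = 0#

  hards : Program → ℕ
  hards []      = 0
  hards (r ∷ P) = hardness (weight r) ℕ.+ hards P

  softs : Program → Carrier
  softs P = ∑ P λ r → softness (weight r)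

  weightValue-split : ∀ w α → weightValue w α ≈ softness w + ι (hardness w) * α
  weightValue-split (soft w) α = sym (trans (+-congˡ (zeroˡ α)) (+-identityʳ w))
  weightValue-split hard     α = sym (trans (+-identityˡ _) (trans (*-congʳ (+-identityʳ 1#)) (*-identityˡ α)))

  ∑-weights : ∀ P α → ∑ P (λ r → weightValue (weight r) α) ≈ softs P + ι (hards P) * α
  ∑-weights []      α = sym (trans (+-identityˡ _) (zeroˡ α))
  ∑-weights (r ∷ P) α = begin-equality
    weightValue w α + ∑ P (λ r → weightValue (weight r) α)                 ≈⟨ +-cong (weightValue-split w α) (∑-weights P α) ⟩
    (softness w + ι (hardness w) * α) + (softs P + ι (hards P) * α)        ≈⟨ solve 5 (λ a b c d e → (a :+ b :* e) :+ (c :+ d :* e) := (a :+ c) :+ (b :+ d) :* e)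
                                                                                refl (softness w) (ι (hardness w)) (softs P) (ι (hards P)) α ⟩
    (softness w + softs P) + (ι (hardness w) + ι (hards P)) * α            ≈⟨ +-congˡ (*-congʳ (ι-+ (hardness w) (hards P))) ⟨
    (softness w + softs P) + ι (hardness w ℕ.+ hards P) * α                ∎
    where w = weight r

  TW≈mono : ∀ P α → TW P α ≈ mono (softs P) (hards P) α
  TW≈mono P α = exp-cong (∑-weights P α)

  TW-++ : ∀ P Q α → TW (P ++ Q) α ≈ TW P α * TW Q α
  TW-++ P Q α = trans (exp-cong (∑-++ _ P Q)) (exp-+ _ _)

  hards-++ : ∀ P Q → hards (P ++ Q) ≡ hards P ℕ.+ hards Q
  hards-++ []      Q = ≡.refl
  hards-++ (r ∷ P) Q = ≡.trans (≡.cong (hardness (weight r) ℕ.+_) (hards-++ P Q))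
                               (≡.sym (ℕ.+-assoc (hardness (weight r)) (hards P) (hards Q)))

  hards-↾ : ∀ P X → hards (P ↾ X) ℕ.≤ hards P
  hards-↾ []      X = z≤n
  hards-↾ (r ∷ P) X with does (X ⊨? formula r)
  ... | true  = ℕ.+-monoʳ-≤ (hardness (weight r)) (hards-↾ P X)
  ... | false = ℕ.≤-trans (hards-↾ P X) (ℕ.m≤n+m (hards P) (hardness (weight r)))

  ↾-++ : ∀ P Q X → (P ++ Q) ↾ X ≡ P ↾ X ++ Q ↾ X
  ↾-++ P Q X = filter-++ (λ r → X ⊨? formula r) P Q

  hards-∪ : ∀ P Q X → hards ((P ∪ Q) ↾ X) ≡ hards (P ↾ X) ℕ.+ hards (Q ↾ X)
  hards-∪ P Q X = ≡.trans (≡.cong hards (↾-++ P Q X)) (hards-++ (P ↾ X) (Q ↾ X))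

  softs-∪ : ∀ P Q X → softs ((P ∪ Q) ↾ X) ≈ softs (P ↾ X) + softs (Q ↾ X)
  softs-∪ P Q X = trans (reflexive (≡.cong softs (↾-++ P Q X))) (∑-++ _ (P ↾ X) (Q ↾ X))

  TW-∪ : ∀ P Q X α → TW ((P ∪ Q) ↾ X) α ≈ TW (P ↾ X) α * TW (Q ↾ X) α
  TW-∪ P Q X α = trans (reflexive (≡.cong (λ R → TW R α) (↾-++ P Q X))) (TW-++ (P ↾ X) (Q ↾ X) α)

  W-stable : ∀ P {X} → SoftStable P X → ∀ α → W P X α ≈ TW (P ↾ X) α
  W-stable P {X} st α rewrite dec-true (em {SoftStable P X}) st = refl

  W-unstable : ∀ P {X} → ¬ SoftStable P X → ∀ α → W P X α ≈ 0#
  W-unstable P {X} ¬st α rewrite dec-false (em {SoftStable P X}) ¬st = refl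

  W≈mono : ∀ P {X} → SoftStable P X → ∀ α → W P X α ≈ mono (softs (P ↾ X)) (hards (P ↾ X)) α
  W≈mono P {X} st α = trans (W-stable P st α) (TW≈mono (P ↾ X) α)

  W-nonneg : ∀ P X α → 0# ≤ W P X α
  W-nonneg P X α with em {SoftStable P X}
  ... | yes _ = proj₁ (0<exp _)
  ... | no  _ = ≤-refl

  W-resp : ∀ P {X Y} → X ≗ Y → ∀ α → W P X α ≈ W P Y α
  W-resp P {X} {Y} X≗Y α = cases (em {SoftStable P X})
    where
    cases : Dec (SoftStable P X) → W P X α ≈ W P Y α
    cases (yes st) = begin-equality
      W P X α       ≈⟨ W-stable P st α ⟩
      TW (P ↾ X) α  ≈⟨ reflexive (≡.cong (λ R → TW R α) (↾-local P (agree-≗ X≗Y))) ⟩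
      TW (P ↾ Y) α  ≈⟨ W-stable P (stable-resp P X≗Y st) α ⟨
      W P Y α       ∎
    cases (no ¬st) = trans (W-unstable P ¬st α)
      (sym (W-unstable P (¬st ∘ stable-resp P (≡.sym ∘ X≗Y)) α))

  -- Independence of the normalising sum from the enumeration.

  ∈-─ : ∀ {X Y Ys} → X ∈ᴵ Ys → (Y∈ : Y ∈ᴵ Ys) → ¬ (Y ≗ X) → X ∈ᴵ (Ys ─ Y∈)
  ∈-─ (here X≗Z)  (here Y≗Z)  Y≭X = contradiction (λ a → ≡.trans (Y≗Z a) (≡.sym (X≗Z a))) Y≭X
  ∈-─ (there X∈)  (here Y≗Z)  Y≭X = X∈
  ∈-─ (here X≗Z)  (there Y∈)  Y≭X = here X≗Z
  ∈-─ (there X∈)  (there Y∈)  Y≭X = there (∈-─ X∈ Y∈ Y≭X)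

  module _ {f : Interpretation → Carrier} (0≤f : ∀ X → 0# ≤ f X)
           (f-resp : ∀ {X Y} → X ≗ Y → f X ≈ f Y) where

    ∑-─ : ∀ {X Xs} (X∈ : X ∈ᴵ Xs) → f X + ∑ (Xs ─ X∈) f ≈ ∑ Xs f
    ∑-─ (here X≗Z) = +-congʳ (f-resp X≗Z)
    ∑-─ {X} {Z ∷ Xs} (there X∈) = begin-equality
      f X + (f Z + ∑ (Xs ─ X∈) f)  ≈⟨ solve 3 (λ a b c → a :+ (b :+ c) := b :+ (a :+ c)) refl (f X) (f Z) (∑ (Xs ─ X∈) f) ⟩
      f Z + (f X + ∑ (Xs ─ X∈) f)  ≈⟨ +-congˡ (∑-─ X∈) ⟩
      f Z + ∑ Xs f                 ∎

    -- Each entry of Xs is matched in Ys and removed there; as Xs has no repetitions, the later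
    -- entries survive the removal.
    ∑-mono-⊆ : ∀ {Xs Ys} → Unique Xs → (∀ {X} → X ∈ᴵ Xs → X ∈ᴵ Ys) → ∑ Xs f ≤ ∑ Ys f
    ∑-mono-⊆ {Ys = Ys} [] Xs⊆Ys = ∑-nonneg Ys 0≤f
    ∑-mono-⊆ {X ∷ Xs} {Ys} (X≭ ∷ unique) Xs⊆Ys = begin
      f X + ∑ Xs f         ≤⟨ +-mono-≤ ≤-refl (∑-mono-⊆ unique λ Z∈ → ∈-─ (Xs⊆Ys (there Z∈)) X∈ (X≭∈ Z∈)) ⟩
      f X + ∑ (Ys ─ X∈) f  ≈⟨ ∑-─ X∈ ⟩
      ∑ Ys f               ∎
      where
      X∈ : X ∈ᴵ Ys
      X∈ = Xs⊆Ys (here λ _ → ≡.refl)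

      X≭∈ : ∀ {Z} → Z ∈ᴵ Xs → ¬ (X ≗ Z)
      X≭∈ Z∈ X≗Z = All.lookupWith (λ X≭V Z≗V → X≭V λ a → ≡.trans (X≗Z a) (Z≗V a)) X≭ Z∈

  ∑W : Program → List Interpretation → Carrier → Carrier
  ∑W P Ys α = ∑ Ys λ Y → W P Y α

  -- `Probability` brings its own enumeration. Comparing two of them in both directions lets all
  -- limits be taken over one fixed list.
  ∑W-unique : ∀ P {Xs Ys} → EnumeratesSM P Xs → EnumeratesSM P Ys → ∀ α → ∑W P Xs α ≈ ∑W P Ys α
  ∑W-unique P (uniqueX , X∈⇔) (uniqueY , Y∈⇔) α = antisym
    (∑-mono-⊆ (λ X → W-nonneg P X α) (λ X≗Y → W-resp P X≗Y α) uniqueX (λ {V} → from (Y∈⇔ V) ∘ to (X∈⇔ V)))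
    (∑-mono-⊆ (λ X → W-nonneg P X α) (λ X≗Y → W-resp P X≗Y α) uniqueY (λ {V} → from (X∈⇔ V) ∘ to (Y∈⇔ V)))

  -- Limit probabilities of interpretations.

  ratio : Program → List Interpretation → Interpretation → Carrier → Carrier
  ratio P Ys X α = W P X α * ∑W P Ys α ⁻¹

  probability-limit : ∀ P {Ys X p} → EnumeratesSM P Ys → Probability P X p → Lim∞ (ratio P Ys X) p
  probability-limit P enum (_ , enum′ , lim) =
    Lim∞-cong (λ α → *-congˡ (⁻¹-cong (∑W-unique P enum′ enum α))) lim

  W≤∑W : ∀ P {Ys X} → EnumeratesSM P Ys → SoftStable P X → ∀ α → W P X α ≤ ∑W P Ys α
  W≤∑W P {X = X} (_ , ∈⇔) st α =
    term≤∑ (λ Y → W-nonneg P Y α) (Any.map (λ X≗Y → W-resp P X≗Y α) (from (∈⇔ X) st))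

  -- The weight of X is the reference monomial for all soft stable models. The normalising sum then
  -- has a leading coefficient L ≥ 1, and the limit is 1 / L.
  dominant-limit : ∀ P {Ys X} → EnumeratesSM P Ys → SoftStable P X →
                   (∀ Y → SoftStable P Y → hards (P ↾ Y) ℕ.≤ hards (P ↾ X)) →
                   ∃ λ p → 0# < p × Lim∞ (ratio P Ys X) p
  dominant-limit P {Ys} {X} enum@(_ , ∈⇔) st dominant = proj₁ limit , proj₁ (proj₂ limit) ,
    Lim∞-cong (λ α → *-congʳ (sym (W≈mono P st α))) (proj₂ (proj₂ limit))
    where
    monos : All (λ Y → IsMonoUpTo (hards (P ↾ X)) (W P Y)) Ys
    monos = All.tabulateₛ InterpretationSetoid λ {Y} Y∈ → let stY = to (∈⇔ Y) Y∈ in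
      softs (P ↾ Y) , hards (P ↾ Y) , dominant Y stY , W≈mono P stY

    limit = Lim∞-leading (λ α → 0<exp _)
      (λ α → ≤-trans (≤-reflexive (sym (W≈mono P st α))) (W≤∑W P {Ys} enum st α))
      (∑-leading (softs (P ↾ X)) monos)

  negligible-limit : ∀ P {Ys X Y} → EnumeratesSM P Ys → SoftStable P X → SoftStable P Y →
                     hards (P ↾ X) ℕ.< hards (P ↾ Y) → Lim∞ (ratio P Ys X) 0#
  negligible-limit P {Ys} {Y = Y} enum stX stY X<Y = Lim∞-negligible _ (softs (P ↾ Y)) X<Y (W≈mono P stX)
    (λ α → ≤-trans (≤-reflexive (sym (W≈mono P stY α))) (W≤∑W P {Ys} enum stY α))

  unstable-limit : ∀ P Ys {X} → ¬ SoftStable P X → Lim∞ (ratio P Ys X) 0#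
  unstable-limit P Ys ¬st = Lim∞-zero λ α → trans (*-congʳ (W-unstable P ¬st α)) (zeroˡ _)

  -- X is unstable, or some soft stable model satisfies more hard rules, or X has the maximal
  -- number; the limit is 0 in the first two cases. Strong equivalence asserts that the
  -- probabilities exist, so their existence has to be supplied.
  limit-exists : ∀ P {Ys} → EnumeratesSM P Ys → ∀ X → ∃ (Lim∞ (ratio P Ys X))
  limit-exists P {Ys} enum X = cases (em {SoftStable P X}) (em {∃ λ Y → SoftStable P Y × hards (P ↾ X) ℕ.< hards (P ↾ Y)})
    where
    cases : Dec (SoftStable P X) → Dec (∃ λ Y → SoftStable P Y × hards (P ↾ X) ℕ.< hards (P ↾ Y)) →
            ∃ (Lim∞ (ratio P Ys X))
    cases (no ¬st) _                   = 0# , unstable-limit P Ys ¬st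
    cases (yes st) (yes (Y , stY , lt)) = 0# , negligible-limit P enum st stY lt
    cases (yes st) (no none)           = proj₁ limit , proj₂ (proj₂ limit)
      where limit = dominant-limit P enum st (λ Y stY → ℕ.≮⇒≥ λ lt → none (Y , stY , lt))

-- Sufficiency: a common factor of all weights cancels.

module StrongEquivalence (em : ExcludedMiddle 0ℓ) (ℝ : Reals) (At : Set) where

  open Reals ℝ
  open RealAnalysis em ℝ
  open LPMLN em ℝ At
  open StableModels em ℝ At
  open PartialOrderReasoning poset
  open SemiringSolver commutativeSemiring using (solve; _:=_; _:+_; _:*_)
  open Equivalence using (to; from)

  ratio-scale : ∀ {k w w′ S S′} → 0# < k → 0# < S → w′ ≈ k * w → S′ ≈ k * S →
                w * S ⁻¹ ≈ w′ * S′ ⁻¹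
  ratio-scale {k} {w} {w′} {S} {S′} 0<k 0<S w′≈kw S′≈kS = *-cancelʳ-≈ 0<S′ (begin-equality
    w * S ⁻¹ * S′        ≈⟨ *-congˡ S′≈kS ⟩
    w * S ⁻¹ * (k * S)   ≈⟨ solve 4 (λ a b c d → a :* b :* (c :* d) := c :* (a :* b :* d)) refl w (S ⁻¹) k S ⟩
    k * (w * S ⁻¹ * S)   ≈⟨ *-congˡ (x*y⁻¹*y≈x w 0<S) ⟩
    k * w                ≈⟨ w′≈kw ⟨
    w′                   ≈⟨ x*y⁻¹*y≈x w′ 0<S′ ⟨
    w′ * S′ ⁻¹ * S′      ∎)
    where
    0<S′ : 0# < S′
    0<S′ = <-≤-trans (*-pos 0<k 0<S) (≤-reflexive (sym S′≈kS))

  reducts⇔models : ∀ F G {X} →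
    ClassicallyEquivalent (reduct* X (dropWeights (F ↾ X))) (reduct* X (dropWeights (G ↾ X))) ⇔
    (∀ Y → Models Y X F ⇔ Models Y X G)
  reducts⇔models F G = mk⇔
    (λ eq Y → mk⇔ (reduct*⇒models G ∘ to (eq Y) ∘ models⇒reduct* F)
                  (reduct*⇒models F ∘ from (eq Y) ∘ models⇒reduct* G))
    (λ eq Y → mk⇔ (models⇒reduct* G ∘ to (eq Y) ∘ reduct*⇒models F)
                  (models⇒reduct* F ∘ from (eq Y) ∘ reduct*⇒models G))

  -- Stability is antitone in the models of the reduct: the fewer of them there are, the fewer can
  -- refute minimality.
  stable-∪-cong : ∀ F G H {X} → (∀ Y → Models Y X G → Models Y X F) →
                  SoftStable (F ∪ H) X → SoftStable (G ∪ H) X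
  stable-∪-cong F G H G⇒F st = stable⁺ (G ∪ H) λ Y Y⊆X m → stable⁻ (F ∪ H) st Y Y⊆X
    (Allₚ.++⁺ (G⇒F Y (Allₚ.++⁻ˡ G m)) (Allₚ.++⁻ʳ G m))

  module Sufficiency (F G : Program) {c : Expression} (0<c : ∀ α → 0# < c α)
                     (scale : ∀ X → TW (F ↾ X) ≈ᵉ c *ᵉ TW (G ↾ X))
                     (models⇔ : ∀ X Y → Models Y X F ⇔ Models Y X G) (H : Program) where

    F⇒G : ∀ {X} → SoftStable (F ∪ H) X → SoftStable (G ∪ H) X
    F⇒G {X} = stable-∪-cong F G H (λ Y → from (models⇔ X Y))

    G⇒F : ∀ {X} → SoftStable (G ∪ H) X → SoftStable (F ∪ H) X
    G⇒F {X} = stable-∪-cong G F H (λ Y → to (models⇔ X Y))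

    W-scale : ∀ X α → W (F ∪ H) X α ≈ c α * W (G ∪ H) X α
    W-scale X α = cases (em {SoftStable (F ∪ H) X})
      where
      cases : Dec (SoftStable (F ∪ H) X) → W (F ∪ H) X α ≈ c α * W (G ∪ H) X α
      cases (yes st) = begin-equality
        W (F ∪ H) X α                             ≈⟨ W-stable (F ∪ H) st α ⟩
        TW ((F ∪ H) ↾ X) α                        ≈⟨ TW-∪ F H X α ⟩
        TW (F ↾ X) α * TW (H ↾ X) α               ≈⟨ *-congʳ (scale X α) ⟩
        c α * TW (G ↾ X) α * TW (H ↾ X) α         ≈⟨ *-assoc _ _ _ ⟩
        c α * (TW (G ↾ X) α * TW (H ↾ X) α)       ≈⟨ *-congˡ (TW-∪ G H X α) ⟨
        c α * TW ((G ∪ H) ↾ X) α                  ≈⟨ *-congˡ (W-stable (G ∪ H) (F⇒G st) α) ⟨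
        c α * W (G ∪ H) X α                       ∎
      cases (no ¬st) = begin-equality
        W (F ∪ H) X α        ≈⟨ W-unstable (F ∪ H) ¬st α ⟩
        0#                   ≈⟨ zeroʳ (c α) ⟨
        c α * 0#             ≈⟨ *-congˡ (W-unstable (G ∪ H) (¬st ∘ G⇒F) α) ⟨
        c α * W (G ∪ H) X α  ∎

    same-probability : ∀ X → ∃ λ p → Probability (F ∪ H) X p × Probability (G ∪ H) X p
    same-probability X = p ,
      -- The list made for `G ∪ H` also enumerates the soft stable models of `F ∪ H`, so both
      -- normalising sums run over the same list.
      (Ys , (unique , λ Y → mk⇔ (G⇒F ∘ to (∈⇔ Y)) (from (∈⇔ Y) ∘ F⇒G)) , Lim∞-cong ratio≈ lim) ,
      (Ys , enum , lim)
      where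
      Ys = proj₁ (enumeration (G ∪ H))
      enum = proj₂ (enumeration (G ∪ H))
      unique = proj₁ enum
      ∈⇔ = proj₂ enum
      p = proj₁ (limit-exists (G ∪ H) enum X)
      lim = proj₂ (limit-exists (G ∪ H) enum X)

      0<∑W : ∀ α → 0# < ∑W (G ∪ H) Ys α
      0<∑W α = <-≤-trans (0<exp _) (≤-trans
        (≤-reflexive (sym (W-stable (G ∪ H) (∅-stable (G ∪ H)) α)))
        (W≤∑W (G ∪ H) enum (∅-stable (G ∪ H)) α))

      ratio≈ : ∀ α → ratio (G ∪ H) Ys X α ≈ ratio (F ∪ H) Ys X α
      ratio≈ α = ratio-scale (0<c α) (0<∑W α) (W-scale X α) (∑-scale Ys λ Y → W-scale Y α)

  -- Test programs that single out interpretations.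

  T-ext : ∀ {x y} → (T x → T y) → (T y → T x) → x ≡ y
  T-ext {true}  {true}  f g = ≡.refl
  T-ext {false} {false} f g = ≡.refl
  T-ext {true}  {false} f g = ⊥-elim (f tt)
  T-ext {false} {true}  f g = ⊥-elim (g tt)

  ¬′_ : Formula → Formula
  ¬′ F = F →′ ⊥′

  ⋀ : List At → (At → Formula) → Formula
  ⋀ []      φ = ⊥′ →′ ⊥′
  ⋀ (a ∷ S) φ = φ a ∧′ ⋀ S φ

  ⊨-⋀⁺ : ∀ {X S} φ → All (λ a → X ⊨ φ a) S → X ⊨ ⋀ S φ
  ⊨-⋀⁺ φ []       = id
  ⊨-⋀⁺ φ (p ∷ ps) = p , ⊨-⋀⁺ φ ps

  ⊨-⋀⁻ : ∀ {X} S φ → X ⊨ ⋀ S φ → All (λ a → X ⊨ φ a) S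
  ⊨-⋀⁻ []      φ _        = []
  ⊨-⋀⁻ (a ∷ S) φ (p , ps) = p ∷ ⊨-⋀⁻ S φ ps

  ht-⋀⁺ : ∀ {X Y S} φ → All (λ a → ⟨ Y , X ⟩⊨ φ a) S → ⟨ Y , X ⟩⊨ ⋀ S φ
  ht-⋀⁺ φ []       = id , id
  ht-⋀⁺ φ (p ∷ ps) = p , ht-⋀⁺ φ ps

  ht-⋀⁻ : ∀ {X Y} S φ → ⟨ Y , X ⟩⊨ ⋀ S φ → All (λ a → ⟨ Y , X ⟩⊨ φ a) S
  ht-⋀⁻ []      φ _        = []
  ht-⋀⁻ (a ∷ S) φ (p , ps) = p ∷ ht-⋀⁻ S φ ps

  softs-zero : ∀ {P} → All (λ r → softness (weight r) ≈ 0#) P → softs P ≈ 0#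
  softs-zero []       = refl
  softs-zero (z ∷ zs) = trans (+-cong z (softs-zero zs)) (+-identityˡ 0#)

  hards-replicate : ∀ K {F} → hards (replicate K (hard ∶ F)) ≡ K
  hards-replicate zero    = ≡.refl
  hards-replicate (suc K) = ≡.cong suc (hards-replicate K)

  -- All test programs consist of one weightless formula φ and of copies of hard
  -- constraints that reward the interpretations agreeing with U or V on S: the
  -- double negations do not affect stability.
  module Probe (S : List At) where

    literal : Interpretation → At → Formula
    literal X a = if X a then atom a else ¬′ atom a

    ⊨-literal⁺ : ∀ X {Y} a → Y a ≡ X a → Y ⊨ literal X a
    ⊨-literal⁺ X {Y} a eq with X a
    ... | true  = ≡.subst T (≡.sym eq) tt
    ... | false = ≡.subst T eq

    ⊨-literal⁻ : ∀ X {Y} a → Y ⊨ literal X a → Y a ≡ X a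
    ⊨-literal⁻ X {Y} a p with X a
    ... | true  = T-ext (λ _ → tt) (λ _ → p)
    ... | false = T-ext p ⊥-elim

    diagram : Interpretation → Formula
    diagram X = ⋀ S (literal X)

    focus : ℕ → Interpretation → Program
    focus K X = replicate K (hard ∶ ¬′ ¬′ diagram X)

    -- In here-and-there logic the truth of a negated formula depends on X alone, so Y satisfies the
    -- reduct of every such constraint that X satisfies.
    models-focus : ∀ {X Y} K U → Models Y X (focus K U)
    models-focus K U = Allₚ.replicate⁺ K λ ¬¬d → ¬¬d , λ h → ¬¬d (proj₁ h)

    hards-focus⁺ : ∀ K {U X} → Agree S X U → hards (focus K U ↾ X) ≡ K
    hards-focus⁺ K {U} {X} X~U = ≡.trans
      (≡.cong hards (filter-all (λ r → X ⊨? formula r)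
        (Allₚ.replicate⁺ K λ ¬d → ¬d (⊨-⋀⁺ (literal U) (All.map (⊨-literal⁺ U _) X~U)))))
      (hards-replicate K)

    hards-focus⁻ : ∀ K {U X} → ¬ Agree S X U → hards (focus K U ↾ X) ≡ 0
    hards-focus⁻ K {U} {X} X≁U = ≡.cong hards (filter-none (λ r → X ⊨? formula r)
      (Allₚ.replicate⁺ K λ ¬¬d → ¬¬d (X≁U ∘ All.map (⊨-literal⁻ U _) ∘ ⊨-⋀⁻ S (literal U))))

    module _ (φ : Formula) (K : ℕ) (U : Interpretation) (L : ℕ) (V : Interpretation) where

      probe : Program
      probe = (soft 0# ∶ φ) ∷ focus K U ++ focus L V

      softs-probe : ∀ X → softs (probe ↾ X) ≈ 0#
      softs-probe X = softs-zero {probe ↾ X} (Allₚ.filter⁺ (λ r → X ⊨? formula r) {xs = probe} weightless)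
        where
        weightless : All (λ r → softness (weight r) ≈ 0#) probe
        weightless = refl ∷ Allₚ.++⁺ (Allₚ.replicate⁺ K refl) (Allₚ.replicate⁺ L refl)

      softs-∪-probe : ∀ P X → softs ((P ∪ probe) ↾ X) ≈ softs (P ↾ X)
      softs-∪-probe P X =
        trans (softs-∪ P probe X) (trans (+-congˡ (softs-probe X)) (+-identityʳ _))

      hards-∪-probe : ∀ P X → hards ((P ∪ probe) ↾ X) ≡
                      hards (P ↾ X) ℕ.+ (hards (focus K U ↾ X) ℕ.+ hards (focus L V ↾ X))
      hards-∪-probe P X = ≡.trans (hards-∪ P probe X) (≡.cong (hards (P ↾ X) ℕ.+_) hards-probe)
        where
        hards-probe : hards (probe ↾ X) ≡ hards (focus K U ↾ X) ℕ.+ hards (focus L V ↾ X)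
        hards-probe with does (X ⊨? φ)
        ... | true  = hards-∪ (focus K U) (focus L V) X
        ... | false = hards-∪ (focus K U) (focus L V) X

      hards-unfocused : ∀ P {X} → ¬ Agree S X U → ¬ Agree S X V →
                        hards ((P ∪ probe) ↾ X) ℕ.≤ hards P
      hards-unfocused P {X} X≁U X≁V = ≡.subst (ℕ._≤ hards P)
        (≡.sym (≡.trans (hards-∪-probe P X) (≡.trans
          (≡.cong (hards (P ↾ X) ℕ.+_) (≡.cong₂ ℕ._+_ (hards-focus⁻ K X≁U) (hards-focus⁻ L X≁V)))
          (ℕ.+-identityʳ _))))
        (hards-↾ P X)

      stable-probe⁺ : ∀ P {X} → X ⊨ φ →
        (∀ Y → Y ⊆ X → Models Y X P → ⟨ Y , X ⟩⊨ φ → X ⊆ Y) → SoftStable (P ∪ probe) X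
      stable-probe⁺ P X⊨φ minimal = stable⁺ (P ∪ probe) λ Y Y⊆X m →
        minimal Y Y⊆X (Allₚ.++⁻ˡ P m) (All.head (Allₚ.++⁻ʳ P m) X⊨φ)

      stable-probe⁻ : ∀ P {X} → SoftStable (P ∪ probe) X →
        ∀ Y → Y ⊆ X → Models Y X P → ⟨ Y , X ⟩⊨ φ → X ⊆ Y
      stable-probe⁻ P st Y Y⊆X m h = stable⁻ (P ∪ probe) st Y Y⊆X
        (Allₚ.++⁺ m ((λ _ → h) ∷ Allₚ.++⁺ (models-focus K U) (models-focus L V)))

    choice : Formula
    choice = ⋀ S λ a → atom a ∨′ ¬′ atom a

    ⊨-choice : ∀ X → X ⊨ choice
    ⊨-choice X = ⊨-⋀⁺ _ (All.universal excluded-middle S)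
      where
      excluded-middle : ∀ a → X ⊨ atom a ∨′ ¬′ atom a
      excluded-middle a with X a
      ... | true  = inj₁ tt
      ... | false = inj₂ id

    -- For a in X the disjunct ¬a fails in X, so the reduct demands a itself and no proper subset of
    -- X remains.
    choice-stable : ∀ K U L V P {X} → (∀ a → T (X a) → a ∈ S) →
                    SoftStable (P ∪ probe choice K U L V) X
    choice-stable K U L V P {X} X⊆S = stable-probe⁺ choice K U L V P (⊨-choice X) λ Y _ _ h a Xa →
      Sum.[ proj₂ ∘ to (T-∧ {X a}) , (λ (¬Xa , _) → ⊥-elim (¬Xa Xa)) ]
        (All.lookup (ht-⋀⁻ S (λ b → atom b ∨′ ¬′ atom b) h) (X⊆S a Xa))

    facts : Interpretation → Formula
    facts X = ⋀ S λ a → if X a then atom a else ⊥′ →′ ⊥′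

    ht-facts⁻ : ∀ {U X Y a} → ⟨ Y , X ⟩⊨ facts U → a ∈ S → T (U a) → T ((X ∩ Y) a)
    ht-facts⁻ {U} {X} {Y} {a} h a∈S Ua with U a | All.lookup (ht-⋀⁻ S (λ b → if U b then atom b else ⊥′ →′ ⊥′) h) a∈S
    ... | true | t = t

    ⊨-facts : ∀ X → X ⊨ facts X
    ⊨-facts X = ⊨-⋀⁺ _ (All.universal fact S)
      where
      fact : ∀ a → X ⊨ (if X a then atom a else ⊥′ →′ ⊥′)
      fact a with X a in eq
      ... | true  = ≡.subst T (≡.sym eq) tt
      ... | false = id

    -- Atoms of Y are required outright, and any other atom of S brings all of X with it; this rules
    -- out everything strictly between Y and X.
    gapClause : Interpretation → Interpretation → At → Formula
    gapClause Y X a = if Y a then atom a else atom a →′ facts X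

    -- For Y ⊆ X the only models V ⊆ X of its reduct relative to X are Y and X.
    gap : Interpretation → Interpretation → Formula
    gap Y X = ⋀ S (gapClause Y X)

    ht-gap : ∀ {X Y} → Y ⊆ X → ⟨ Y , X ⟩⊨ gap Y X
    ht-gap {X} {Y} Y⊆X = ht-⋀⁺ (gapClause Y X) (All.universal clause S)
      where
      clause : ∀ a → ⟨ Y , X ⟩⊨ gapClause Y X a
      clause a with Y a in eq
      ... | true  = from T-∧ (Y⊆X a (≡.subst T (≡.sym eq) tt) , ≡.subst T (≡.sym eq) tt)
      ... | false = (λ _ → ⊨-facts X) , λ t → ⊥-elim (≡.subst T eq (proj₂ (to (T-∧ {X a}) t)))

    gap-lower : ∀ {X Y V a} → ⟨ V , X ⟩⊨ gap Y X → a ∈ S → T (Y a) → T (V a)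
    gap-lower {X} {Y} {V} {a} h a∈S Ya with Y a | All.lookup (ht-⋀⁻ S (gapClause Y X) h) a∈S
    ... | true | t = proj₂ (to (T-∧ {X a}) t)

    gap-jump : ∀ {X Y V a} → ⟨ V , X ⟩⊨ gap Y X → a ∈ S → T ((X ∩ V) a) → ¬ T (Y a) →
               ⟨ V , X ⟩⊨ facts X
    gap-jump {X} {Y} {V} {a} h a∈S t ¬Ya with Y a | All.lookup (ht-⋀⁻ S (gapClause Y X) h) a∈S
    ... | true  | _       = ⊥-elim (¬Ya tt)
    ... | false | _ , h→  = h→ t

  -- Positive and proportional limits.

  positive-limit : ∀ P {Ys X p} → EnumeratesSM P Ys → SoftStable P X →
                   (∀ Y → hards (P ↾ Y) ℕ.≤ hards (P ↾ X)) → Lim∞ (ratio P Ys X) p → 0# < p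
  positive-limit P enum st dominant lim = <-≤-trans (proj₁ (proj₂ limit))
    (≤-reflexive (Lim∞-unique (proj₂ (proj₂ limit)) lim))
    where limit = dominant-limit P enum st λ Y _ → dominant Y

  -- With equally many hard rules the power of e^α is the same for X and V, so the two ratios are in
  -- the proportion of their soft weights for every α, and this passes to the limit.
  limits-proportional : ∀ P Ys {X V p q} → SoftStable P X → SoftStable P V →
    hards (P ↾ X) ≡ hards (P ↾ V) → Lim∞ (ratio P Ys X) p → Lim∞ (ratio P Ys V) q →
    p * exp (softs (P ↾ V)) ≈ q * exp (softs (P ↾ X))
  limits-proportional P Ys {X} {V} stX stV X≡V limX limV =
    Lim∞-scaled (0<exp _) (0<exp _) limX limV λ α → begin-equality
      W P X α * ∑W P Ys α ⁻¹ * eV               ≈⟨ *-congʳ (*-congʳ (trans (W≈mono P stX α) (mono-split (softs (P ↾ X)) (hards (P ↾ X)) α))) ⟩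
      eX * e (hards (P ↾ X)) α * ∑W P Ys α ⁻¹ * eV  ≈⟨ solve 4 (λ a b c d → a :* b :* c :* d := d :* b :* c :* a) refl eX (e (hards (P ↾ X)) α) (∑W P Ys α ⁻¹) eV ⟩
      eV * e (hards (P ↾ X)) α * ∑W P Ys α ⁻¹ * eX  ≈⟨ *-congʳ (*-congʳ (*-congˡ (reflexive (≡.cong (λ n → e n α) X≡V)))) ⟩
      eV * e (hards (P ↾ V)) α * ∑W P Ys α ⁻¹ * eX  ≈⟨ *-congʳ (*-congʳ (trans (W≈mono P stV α) (mono-split (softs (P ↾ V)) (hards (P ↾ V)) α))) ⟨
      W P V α * ∑W P Ys α ⁻¹ * eX               ∎
    where
    eX = exp (softs (P ↾ X))
    eV = exp (softs (P ↾ V))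
    e : ℕ → Carrier → Carrier
    e n α = exp (ι n * α)

  -- Necessity: reading reducts and weights off the probabilities.

  module Necessity (F G : Program) (F≡G : StronglyEquivalent F G) where

    S : List At
    S = atoms* F ++ atoms* G

    open Probe S

    common-limit : ∀ H X {Ys Zs} → EnumeratesSM (F ∪ H) Ys → EnumeratesSM (G ∪ H) Zs →
                   ∃ λ p → Lim∞ (ratio (F ∪ H) Ys X) p × Lim∞ (ratio (G ∪ H) Zs X) p
    common-limit H X enumF enumG = proj₁ (F≡G H X) ,
      probability-limit (F ∪ H) enumF (proj₁ (proj₂ (F≡G H X))) ,
      probability-limit (G ∪ H) enumG (proj₂ (proj₂ (F≡G H X)))

    ↾-localF : ∀ {X Y} → Agree S X Y → F ↾ X ≡ F ↾ Y
    ↾-localF ag = ↾-local F (Allₚ.++⁻ˡ (atoms* F) ag)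

    ↾-localG : ∀ {X Y} → Agree S X Y → G ↾ X ≡ G ↾ Y
    ↾-localG ag = ↾-local G (Allₚ.++⁻ʳ (atoms* F) ag)

    -- If Y satisfied the reduct of F but not that of G, then gap Y X would make
    -- X stable for G but not for F.
    models-⊆ : ∀ {X Y} → (∀ a → T (X a) → a ∈ S) → Y ⊆ X → Models Y X F → Models Y X G
    models-⊆ {X} {Y} X⊆S Y⊆X mF = decidable-stable em λ ¬mG →
      pos⇒≉0 (positive-limit (G ∪ H) enumG (stableG ¬mG) dominant (proj₂ (proj₂ limit)))
        (Lim∞-unique (proj₁ (proj₂ limit)) (unstable-limit (F ∪ H) Ys (unstableF ¬mG)))
      where
      -- `hards G` copies suffice: an interpretation that disagrees with X on S satisfies at most
      -- `hards G` hard rules, while X gets that many from the copies alone. One focus is enough, so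
      -- the second has 0 copies.
      H = probe (gap Y X) (hards G) X 0 X
      Ys = proj₁ (enumeration (F ∪ H))
      enumF = proj₂ (enumeration (F ∪ H))
      enumG = proj₂ (enumeration (G ∪ H))
      limit = common-limit H X enumF enumG

      unstableF : ¬ Models Y X G → ¬ SoftStable (F ∪ H) X
      -- Stability would give X ⊆ Y, hence Y = X, and X satisfies all reducts relative to itself.
      unstableF ¬mG st = ¬mG (models-local G (agree-≗ λ _ → ≡.refl)
        (agree-∩ (agree-≗ {X = X} λ _ → ≡.refl) (agree-≗ λ a → T-ext (X⊆Y a) (Y⊆X a))) (models-refl X G))
        where
        X⊆Y : X ⊆ Y
        X⊆Y = stable-probe⁻ (gap Y X) (hards G) X 0 X F st Y Y⊆X mF (ht-gap Y⊆X)

      stableG : ¬ Models Y X G → SoftStable (G ∪ H) X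
      stableG ¬mG = stable-probe⁺ (gap Y X) (hards G) X 0 X G (ht⇒⊨ (gap Y X) (ht-gap Y⊆X))
        λ V V⊆X mV h → cases V V⊆X mV h em
        where
        -- Either V has an atom outside Y, and the gap formula forces all of X into V, or V = Y,
        -- which fails the reduct of G.
        cases : ∀ V → V ⊆ X → Models V X G → ⟨ V , X ⟩⊨ gap Y X →
                Dec (∃ λ a → T (V a) × ¬ T (Y a)) → X ⊆ V
        cases V V⊆X mV h (yes (a , Va , ¬Ya)) b Xb = proj₂ (to (T-∧ {X b})
          (ht-facts⁻ {X} (gap-jump {X} {Y} h (X⊆S a (V⊆X a Va)) (from T-∧ (V⊆X a Va , Va)) ¬Ya) (X⊆S b Xb) Xb))
        cases V V⊆X mV h (no V∖Y≡∅) = contradiction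
          (models-local G (agree-≗ λ _ → ≡.refl) (agree-∩ (agree-≗ {X = X} λ _ → ≡.refl) (agree-≗ V≗Y)) mV) ¬mG
          where
          V≗Y : V ≗ Y
          V≗Y a = T-ext (λ Va → decidable-stable em λ ¬Ya → V∖Y≡∅ (a , Va , ¬Ya))
                        (λ Ya → gap-lower {X} h (X⊆S a (Y⊆X a Ya)) Ya)

      hardsX : ∀ {V} → Agree S V X → hards ((G ∪ H) ↾ V) ≡ hards (G ↾ X) ℕ.+ (hards G ℕ.+ 0)
      hardsX {V} V~X = ≡.trans (hards-∪-probe (gap Y X) (hards G) X 0 X G V)
        (≡.cong₂ (λ P n → hards P ℕ.+ (n ℕ.+ 0)) (↾-localG V~X) (hards-focus⁺ (hards G) V~X))

      dominant : ∀ V → hards ((G ∪ H) ↾ V) ℕ.≤ hards ((G ∪ H) ↾ X)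
      dominant V = cases em
        where
        cases : Dec (Agree S V X) → hards ((G ∪ H) ↾ V) ℕ.≤ hards ((G ∪ H) ↾ X)
        cases (yes V~X) = ℕ.≤-reflexive (≡.trans (hardsX V~X) (≡.sym (hardsX (agree-≗ λ _ → ≡.refl))))
        cases (no V≁X) = ℕ.≤-trans (hards-unfocused (gap Y X) (hards G) X 0 X G V≁X V≁X)
          (≡.subst (hards G ℕ.≤_) (≡.sym (hardsX (agree-≗ λ _ → ≡.refl)))
            (ℕ.≤-trans (ℕ.m≤m+n (hards G) 0) (ℕ.m≤n+m _ (hards (G ↾ X)))))

    -- Only X and X ∩ Y on S matter. Hence X may be cut down to S and Y to its part inside that set,
    -- which brings `models-⊆` into play.
    models-⇒ : ∀ {X Y} → Models Y X F → Models Y X G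
    models-⇒ {X} {Y} mF = models-local G (Allₚ.++⁻ʳ (atoms* F) X′~X) (Allₚ.++⁻ʳ (atoms* F) X′Y′~XY)
      (models-⊆ (∣-∈ X S) (λ a → proj₂ ∘ to (T-∧ {Y a}))
        (models-local F (agree-sym (Allₚ.++⁻ˡ (atoms* F) X′~X)) (agree-sym (Allₚ.++⁻ˡ (atoms* F) X′Y′~XY)) mF))
      where
      X′ = X ∣ S
      Y′ = Y ∩ X′

      X′~X : Agree S X′ X
      X′~X = agree-∣ X S

      X′Y′~XY : Agree S (X′ ∩ Y′) (X ∩ Y)
      X′Y′~XY = All.map (λ {a} eq → ≡.trans (≡.cong (λ x → x ∧ (Y a ∧ x)) eq) (absorb (X a) (Y a))) X′~X
        where
        absorb : ∀ x y → x ∧ (y ∧ x) ≡ x ∧ y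
        absorb true  true  = ≡.refl
        absorb true  false = ≡.refl
        absorb false y     = ≡.refl

    -- The number of copies of the constraints is chosen so that X and V become
    -- the most probable interpretations with the same power of e^α.
    module Balance {X V} (X⊆S : ∀ a → T (X a) → a ∈ S) (V⊆S : ∀ a → T (V a) → a ∈ S)
                   (X≁V : ¬ Agree S X V) where

      -- X is rewarded with the count of V and V with that of X, so both totals agree. The extra
      -- `hards F` in each keeps them above every interpretation agreeing with neither.
      K = hards (F ↾ V) ℕ.+ hards F
      L = hards (F ↾ X) ℕ.+ hards F
      H = probe choice K X L V

      -- As X and V disagree on S, no Y collects both rewards. P is arbitrary because the count is
      -- needed for G as well as for F.
      hardsX : ∀ P {Y} → Agree S Y X → hards ((P ∪ H) ↾ Y) ≡ hards (P ↾ Y) ℕ.+ K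
      hardsX P {Y} Y~X = ≡.trans (hards-∪-probe choice K X L V P Y)
        (≡.cong (hards (P ↾ Y) ℕ.+_) (≡.trans
          (≡.cong₂ ℕ._+_ (hards-focus⁺ K Y~X) (hards-focus⁻ L Y≁V)) (ℕ.+-identityʳ K)))
        where
        Y≁V : ¬ Agree S Y V
        Y≁V Y~V = X≁V (All.zipWith (λ (y≡x , y≡v) → ≡.trans (≡.sym y≡x) y≡v) (Y~X , Y~V))

      hardsV : ∀ P {Y} → Agree S Y V → hards ((P ∪ H) ↾ Y) ≡ hards (P ↾ Y) ℕ.+ L
      hardsV P {Y} Y~V = ≡.trans (hards-∪-probe choice K X L V P Y)
        (≡.cong (hards (P ↾ Y) ℕ.+_) (≡.cong₂ ℕ._+_ (hards-focus⁻ K Y≁X) (hards-focus⁺ L Y~V)))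
        where
        Y≁X : ¬ Agree S Y X
        Y≁X Y~X = X≁V (All.zipWith (λ (y≡x , y≡v) → ≡.trans (≡.sym y≡x) y≡v) (Y~X , Y~V))

      agree-refl : ∀ {Y} → Agree S Y Y
      agree-refl = agree-≗ λ _ → ≡.refl

      balanced : hards ((F ∪ H) ↾ X) ≡ hards ((F ∪ H) ↾ V)
      balanced = ≡.trans (hardsX F agree-refl) (≡.trans
        (x+[y+z]≡y+[x+z] (hards (F ↾ X)) (hards (F ↾ V)) (hards F)) (≡.sym (hardsV F agree-refl)))
        where
        x+[y+z]≡y+[x+z] : ∀ x y z → x ℕ.+ (y ℕ.+ z) ≡ y ℕ.+ (x ℕ.+ z)
        x+[y+z]≡y+[x+z] x y z = ≡.trans (≡.sym (ℕ.+-assoc x y z))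
          (≡.trans (≡.cong (ℕ._+ z) (ℕ.+-comm x y)) (ℕ.+-assoc y x z))

      dominantX : ∀ Y → hards ((F ∪ H) ↾ Y) ℕ.≤ hards ((F ∪ H) ↾ X)
      dominantX Y = cases em em
        where
        cases : Dec (Agree S Y X) → Dec (Agree S Y V) → hards ((F ∪ H) ↾ Y) ℕ.≤ hards ((F ∪ H) ↾ X)
        cases (yes Y~X) _ = ℕ.≤-reflexive (≡.trans (hardsX F Y~X)
          (≡.trans (≡.cong (λ P → hards P ℕ.+ K) (↾-localF Y~X)) (≡.sym (hardsX F agree-refl))))
        cases (no _) (yes Y~V) = ℕ.≤-reflexive (≡.trans (hardsV F Y~V)
          (≡.trans (≡.cong (λ P → hards P ℕ.+ L) (↾-localF Y~V)) (≡.trans (≡.sym (hardsV F agree-refl)) (≡.sym balanced))))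
        cases (no Y≁X) (no Y≁V) = ℕ.≤-trans (hards-unfocused choice K X L V F Y≁X Y≁V)
          (≡.subst (hards F ℕ.≤_) (≡.sym (hardsX F agree-refl))
            (ℕ.≤-trans (ℕ.m≤n+m (hards F) (hards (F ↾ V))) (ℕ.m≤n+m K (hards (F ↾ X)))))

      Ys = proj₁ (enumeration (F ∪ H))
      enumF = proj₂ (enumeration (F ∪ H))
      Zs = proj₁ (enumeration (G ∪ H))
      enumG = proj₂ (enumeration (G ∪ H))

      limitX = common-limit H X enumF enumG
      limitV = common-limit H V enumF enumG
      p = proj₁ limitX
      q = proj₁ limitV

      stableX : ∀ P → SoftStable (P ∪ H) X
      stableX P = choice-stable K X L V P X⊆S

      stableV : ∀ P → SoftStable (P ∪ H) V
      stableV P = choice-stable K X L V P V⊆S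

      0<p : 0# < p
      0<p = positive-limit (F ∪ H) enumF (stableX F) dominantX (proj₁ (proj₂ limitX))

      0<q : 0# < q
      0<q = positive-limit (F ∪ H) enumF (stableV F)
        (λ Y → ℕ.≤-trans (dominantX Y) (ℕ.≤-reflexive balanced)) (proj₁ (proj₂ limitV))

      -- K and L are tuned to F only. But both limits are positive and shared with G, where an
      -- interpretation with fewer hard rules than the other would have limit 0.
      balancedG : hards ((G ∪ H) ↾ X) ≡ hards ((G ∪ H) ↾ V)
      balancedG = ℕ.≤-antisym
        (ℕ.≮⇒≥ λ V<X → pos⇒≉0 0<q (Lim∞-unique (proj₂ (proj₂ limitV))
          (negligible-limit (G ∪ H) enumG (stableV G) (stableX G) V<X)))
        (ℕ.≮⇒≥ λ X<V → pos⇒≉0 0<p (Lim∞-unique (proj₂ (proj₂ limitX))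
          (negligible-limit (G ∪ H) enumG (stableX G) (stableV G) X<V)))

      hards-exchange : hards (F ↾ X) ℕ.+ hards (G ↾ V) ≡ hards (F ↾ V) ℕ.+ hards (G ↾ X)
      hards-exchange = ℕ.+-cancelʳ-≡ (hards F) _ _ (≡.trans (rearrange (hards (F ↾ X)) (hards (G ↾ V)))
        (≡.trans (≡.sym (≡.trans (≡.sym (hardsX G agree-refl)) (≡.trans balancedG (hardsV G agree-refl))))
          (≡.sym (rearrange (hards (F ↾ V)) (hards (G ↾ X))))))
        where
        rearrange : ∀ x y → (x ℕ.+ y) ℕ.+ hards F ≡ y ℕ.+ (x ℕ.+ hards F)
        rearrange x y = ≡.trans (≡.cong (ℕ._+ hards F) (ℕ.+-comm x y)) (ℕ.+-assoc y x (hards F))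

      e : Program → Interpretation → Carrier
      e P Y = exp (softs (P ↾ Y))

      proportional : ∀ P Xs → hards ((P ∪ H) ↾ X) ≡ hards ((P ∪ H) ↾ V) →
        Lim∞ (ratio (P ∪ H) Xs X) p → Lim∞ (ratio (P ∪ H) Xs V) q → p * e P V ≈ q * e P X
      proportional P Xs X≡V limX limV = begin-equality
        p * e P V          ≈⟨ *-congˡ (exp-cong (softs-∪-probe choice K X L V P V)) ⟨
        p * e (P ∪ H) V    ≈⟨ limits-proportional (P ∪ H) Xs (stableX P) (stableV P) X≡V limX limV ⟩
        q * e (P ∪ H) X    ≈⟨ *-congˡ (exp-cong (softs-∪-probe choice K X L V P X)) ⟩
        q * e P X          ∎

      -- For both programs the quotient of the soft weights of X and V equals p / q, with the same p
      -- and q; the identity is this equality multiplied out.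
      softs-exchange : e F X * e G V ≈ e F V * e G X
      softs-exchange = *-cancelʳ-≈ 0<q (begin-equality
        e F X * e G V * q    ≈⟨ solve 3 (λ a b c → a :* b :* c := c :* a :* b) refl (e F X) (e G V) q ⟩
        q * e F X * e G V    ≈⟨ *-congʳ (proportional F Ys balanced (proj₁ (proj₂ limitX)) (proj₁ (proj₂ limitV))) ⟨
        p * e F V * e G V    ≈⟨ solve 3 (λ a b c → a :* b :* c := b :* (a :* c)) refl p (e F V) (e G V) ⟩
        e F V * (p * e G V)  ≈⟨ *-congˡ (proportional G Zs balancedG (proj₂ (proj₂ limitX)) (proj₂ (proj₂ limitV))) ⟩
        e F V * (q * e G X)  ≈⟨ solve 3 (λ a b c → a :* (b :* c) := a :* c :* b) refl (e F V) q (e G X) ⟩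
        e F V * e G X * q    ∎)

      TW-product : ∀ P Q α → TW P α * TW Q α ≈ exp (softs P) * exp (softs Q) * exp (ι (hards P ℕ.+ hards Q) * α)
      TW-product P Q α = begin-equality
        TW P α * TW Q α
          ≈⟨ *-cong (trans (TW≈mono P α) (mono-split (softs P) (hards P) α))
                    (trans (TW≈mono Q α) (mono-split (softs Q) (hards Q) α)) ⟩
        (exp (softs P) * exp (ι (hards P) * α)) * (exp (softs Q) * exp (ι (hards Q) * α))
          ≈⟨ solve 4 (λ a b c d → (a :* b) :* (c :* d) := a :* c :* (b :* d)) refl
               (exp (softs P)) (exp (ι (hards P) * α)) (exp (softs Q)) (exp (ι (hards Q) * α)) ⟩
        exp (softs P) * exp (softs Q) * (exp (ι (hards P) * α) * exp (ι (hards Q) * α))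
          ≈⟨ *-congˡ (trans (sym (exp-+ _ _)) (exp-cong (sym (trans (*-congʳ (ι-+ (hards P) (hards Q))) (distribʳ α _ _))))) ⟩
        exp (softs P) * exp (softs Q) * exp (ι (hards P ℕ.+ hards Q) * α) ∎

      TW-balance : ∀ α → TW (F ↾ X) α * TW (G ↾ V) α ≈ TW (F ↾ V) α * TW (G ↾ X) α
      TW-balance α = begin-equality
        TW (F ↾ X) α * TW (G ↾ V) α                                               ≈⟨ TW-product (F ↾ X) (G ↾ V) α ⟩
        e F X * e G V * exp (ι (hards (F ↾ X) ℕ.+ hards (G ↾ V)) * α)             ≈⟨ *-cong softs-exchange (reflexive (≡.cong (λ n → exp (ι n * α)) hards-exchange)) ⟩
        e F V * e G X * exp (ι (hards (F ↾ V) ℕ.+ hards (G ↾ X)) * α)             ≈⟨ TW-product (F ↾ V) (G ↾ X) α ⟨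
        TW (F ↾ V) α * TW (G ↾ X) α                                               ∎

    -- Balancing requires two interpretations that differ on S. If X has no atom in S, it acts like
    -- ∅ on both programs and the two sides coincide.
    TW-exchange : ∀ X α → TW (F ↾ X) α * TW (G ↾ ∅) α ≈ TW (F ↾ ∅) α * TW (G ↾ X) α
    TW-exchange X α = cases em
      where
      cases : Dec (Agree S (X ∣ S) ∅) → TW (F ↾ X) α * TW (G ↾ ∅) α ≈ TW (F ↾ ∅) α * TW (G ↾ X) α
      cases (yes X′~∅) = reflexive (≡.cong₂ (λ P Q → TW P α * TW Q α)
        (↾-localF X~∅) (↾-localG (agree-sym X~∅)))
        where
        X~∅ : Agree S X ∅
        X~∅ = All.zipWith (λ (x′≡x , x′≡⊥) → ≡.trans (≡.sym x′≡x) x′≡⊥) (agree-∣ X S , X′~∅)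
      cases (no X′≁∅) = ≡.subst₂ (λ P Q → TW P α * TW (G ↾ ∅) α ≈ TW (F ↾ ∅) α * TW Q α)
        (↾-localF (agree-∣ X S)) (↾-localG (agree-∣ X S))
        (Balance.TW-balance (∣-∈ X S) (λ _ ()) X′≁∅ α)

    -- The factor is read off at X = ∅. The difference of the hard counts may be negative, hence the
    -- integer subtraction `_⊖_`.
    c : WExpression
    c = e^[ softs (F ↾ ∅) - softs (G ↾ ∅) + hards (F ↾ ∅) ⊖ hards (G ↾ ∅) α]

    TW-∅ : ∀ α → TW (F ↾ ∅) α ≈ ⟦ c ⟧ α * TW (G ↾ ∅) α
    TW-∅ α = begin-equality
      TW (F ↾ ∅) α                              ≈⟨ TW≈mono (F ↾ ∅) α ⟩
      exp (sF + ι nF * α)                       ≈⟨ exp-cong (+-cong ([x-y]+y≈x sF sG) (*-congʳ (fromℤ-⊖ nF nG))) ⟨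
      exp ((s + sG) + (n + ι nG) * α)           ≈⟨ exp-cong (solve 5 (λ a b c d e → (a :+ b) :+ (c :+ d) :* e := (a :+ c :* e) :+ (b :+ d :* e)) refl s sG n (ι nG) α) ⟩
      exp ((s + n * α) + (sG + ι nG * α))       ≈⟨ exp-+ _ _ ⟩
      ⟦ c ⟧ α * exp (sG + ι nG * α)             ≈⟨ *-congˡ (TW≈mono (G ↾ ∅) α) ⟨
      ⟦ c ⟧ α * TW (G ↾ ∅) α                    ∎
      where
      sF = softs (F ↾ ∅)
      sG = softs (G ↾ ∅)
      nF = hards (F ↾ ∅)
      nG = hards (G ↾ ∅)
      s = sF - sG
      n = fromℤ (nF ⊖ nG)

    TW-scale : ∀ X → TW (F ↾ X) ≈ᵉ ⟦ c ⟧ *ᵉ TW (G ↾ X)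
    TW-scale X α = *-cancelʳ-≈ (0<exp _) (begin-equality
      TW (F ↾ X) α * TW (G ↾ ∅) α              ≈⟨ TW-exchange X α ⟩
      TW (F ↾ ∅) α * TW (G ↾ X) α              ≈⟨ *-congʳ (TW-∅ α) ⟩
      ⟦ c ⟧ α * TW (G ↾ ∅) α * TW (G ↾ X) α    ≈⟨ solve 3 (λ a b c → a :* b :* c := a :* c :* b) refl (⟦ c ⟧ α) (TW (G ↾ ∅) α) (TW (G ↾ X) α) ⟩
      ⟦ c ⟧ α * TW (G ↾ X) α * TW (G ↾ ∅) α    ∎)

  strongEquivalence-sym : ∀ F G → StronglyEquivalent F G → StronglyEquivalent G F
  strongEquivalence-sym F G F≡G H X = proj₁ (F≡G H X) , Product.swap (proj₂ (F≡G H X))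

-- Joining the two implications of the characterisation.

theorem2 : (em : ExcludedMiddle 0ℓ) (ℝ : Reals) (At : Set) →
    let open LPMLN em ℝ At in
    (F G : Program) →
    StronglyEquivalent F G ⇔
    (∃ λ (c : WExpression) → ∀ (X : Interpretation) →
    (TW (F ↾ X) ≈ᵉ ⟦ c ⟧ *ᵉ TW (G ↾ X)) ×
    ClassicallyEquivalent (reduct* X (dropWeights (F ↾ X))) (reduct* X (dropWeights (G ↾ X))))
theorem2 em ℝ At F G = mk⇔ necessary sufficient
  where
  open LPMLN em ℝ At
  open RealAnalysis em ℝ using (0<exp)
  open StrongEquivalence em ℝ At

  Condition : WExpression → Set
  Condition c = ∀ X → (TW (F ↾ X) ≈ᵉ ⟦ c ⟧ *ᵉ TW (G ↾ X)) ×
    ClassicallyEquivalent (reduct* X (dropWeights (F ↾ X))) (reduct* X (dropWeights (G ↾ X)))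

  necessary : StronglyEquivalent F G → ∃ Condition
  necessary F≡G = FG.c , λ X → FG.TW-scale X ,
    Equivalence.from (reducts⇔models F G) λ Y → mk⇔ FG.models-⇒ GF.models-⇒
    where
    module FG = Necessity F G F≡G
    -- Only one inclusion between the models of the reducts is proved for an ordered pair of
    -- programs; symmetry of strong equivalence yields the other.
    module GF = Necessity G F (strongEquivalence-sym F G F≡G)

  sufficient : ∃ Condition → StronglyEquivalent F G
  sufficient (c , h) = Sufficiency.same-probability F G (λ α → 0<exp _) (λ X → proj₁ (h X))
    (λ X → Equivalence.to (reducts⇔models F G) (proj₂ (h X)))
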